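{- The SoftMHV problem can be approximated within a factor of $\Omega(\Delta^{ -3})$ in polynomial time, where $\Delta$ is the maximum degree of vertices in the input graph. That is, there exist an absolute constant $\alpha>0$ and a polynomial-time algorithm which, on every SoftMHV instance whose graph has maximum degree $\Delta\ge1$, outputs a total vertex coloring extending the given partial coloring whose number of happy vertices is at least $\alpha\,\Delta^{ -3}\cdot OPT$, where $OPT$ is the maximum number of happy vertices over all total colorings extending the given partial coloring.
   Context: SoftMHV problem (Maximum Happy Vertices with soft threshold): let $\rho\in(0,1)$ be a number (either a constant or part of the input). An instance consists of a connected undirected graph $G=(V,E)$, a color set $C=\{1,2,\ldots,k\}$, and a partial vertex coloring $c\colon V\to C$ (i.e. $c$ assigns colors to only part of the vertices). Under a total coloring $c'\colon V\to C$, a vertex $v$ is happy if at least $\rho\cdot\deg(v)$ of its neighbors have the same color as $v$. The task is to find a total coloring extending $c$ (agreeing with $c$ wherever $c$ is defined) that maximizes the number of happy vertices.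
   Formalization: The threshold ρ is taken to be a rational number in (0,1), given as part of the input; irrational constant values of ρ are not covered. -}

module Defs where

open import Data.Bool.Base using (Bool; true; false)
open import Data.Fin.Base using (Fin; toℕ)
import Data.Fin.Properties as Fin
open import Data.Integer.Base using (+_; ∣_∣)
open import Data.List.Base using (List; []; _∷_; map; filter; length; allFin)
open import Data.List.Extrema.Nat using (max)
open import Data.Maybe.Base using (Maybe; just; nothing)
open import Data.Nat.Base using (ℕ; suc; _+_; _*_; _^_; _≤_; NonZero)
open import Data.Nat.Binary.Base using (ℕᵇ; zero; 2[1+_]; 1+[2_]; fromℕ)
open import Data.Nat.Properties using (m^n≢0)
open import Data.Product.Base using (∃-syntax; _×_)
open import Data.Rational.Base as ℚ using (ℚ; 0ℚ; 1ℚ; _/_; ↥_; ↧ₙ_)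
import Data.Rational.Properties as ℚ
open import Level using (Level; 0ℓ)
open import Relation.Binary.Construct.Closure.ReflexiveTransitive using (Star)
open import Relation.Binary.Core using (Rel)
open import Relation.Binary.Definitions using (Decidable; Symmetric; Irreflexive)
open import Relation.Binary.PropositionalEquality.Core using (_≡_)
open import Relation.Nullary.Decidable.Core using (Dec; does; _×-dec_)

record Graph (n : ℕ) : Set₁ where
  field
    _~_       : Rel (Fin n) 0ℓ
    _~?_      : Decidable _~_
    ~-sym     : Symmetric _~_
    ~-irrefl  : Irreflexive _≡_ _~_

  Connected : Set
  Connected = ∀ u v → Star _~_ u v

  deg : Fin n → ℕ
  deg v = length (filter (v ~?_) (allFin n))

  maxDeg : ℕ
  maxDeg = max 0 (map deg (allFin n))

-- The threshold ρ is part of the input, so an algorithm has to be uniform in it.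
record Instance : Set₁ where
  field
    n          : ℕ
    graph      : Graph n
    connected  : Graph.Connected graph
    k          : ℕ
    k-nonZero  : NonZero k
    c          : Fin n → Maybe (Fin k)
    ρ          : ℚ
    0<ρ        : 0ℚ ℚ.< ρ
    ρ<1        : ρ ℚ.< 1ℚ

  open Graph graph public

  Colouring : Set
  Colouring = Fin n → Fin k

  Extends : Colouring → Set
  Extends c′ = ∀ v i → c v ≡ just i → c′ v ≡ i

  sameColouredNeighbours : Colouring → Fin n → ℕ
  sameColouredNeighbours c′ v =
    length (filter (λ u → (v ~? u) ×-dec (c′ u Fin.≟ c′ v)) (allFin n))

  Happy : Colouring → Fin n → Set
  Happy c′ v = ρ ℚ.* (+ deg v / 1) ℚ.≤ (+ sameColouredNeighbours c′ v / 1)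

  happy? : ∀ c′ v → Dec (Happy c′ v)
  happy? c′ v = ρ ℚ.* (+ deg v / 1) ℚ.≤? (+ sameColouredNeighbours c′ v / 1)

  #happy : Colouring → ℕ
  #happy c′ = length (filter (happy? c′) (allFin n))

  IsOPT : ℕ → Set
  IsOPT m = (∃[ c′ ] Extends c′ × #happy c′ ≡ m)
          × (∀ c′ → Extends c′ → #happy c′ ≤ m)

open Instance public using (Colouring; Extends; #happy; IsOPT; maxDeg)

-- The model of computation has the data (binary trees over a single atom), the
-- primitives and the unit-cost measure of Jones' WHILE language, in a
-- variable-free presentation: a program maps one tree to one tree, and ⟨ p , q ⟩
-- runs both programs on the same input.  Trees are immutable and can be shared
-- by pointers, so every step costs O(1) pointer operations; the programs running
-- in polynomial time are therefore polynomially equivalent to polynomial-time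
-- Turing machines.
data Tree : Set where
  nil   : Tree
  cons  : Tree → Tree → Tree

size : Tree → ℕ
size nil         = 1
size (cons x y)  = suc (size x + size y)

head tail : Tree → Tree
head nil         = nil
head (cons x y)  = x
tail nil         = nil
tail (cons x y)  = y

infixl 5 _⨾_

data Program : Set where
  idₚ nilₚ headₚ tailₚ  : Program
  ⟨_,_⟩                 : Program → Program → Program
  _⨾_                   : Program → Program → Program
  if_then_else_         : Program → Program → Program → Program
  while_loop_           : Program → Program → Program

infix 4 _·_⇓_[_]

-- p · x ⇓ y [ t ]: on input x the program p halts with output y after t steps.
-- In a test, nil means false and every other tree means true.
data _·_⇓_[_] : Program → Tree → Tree → ℕ → Set where
  ⇓-id     : ∀ {x} → idₚ · x ⇓ x [ 1 ]
  ⇓-nil    : ∀ {x} → nilₚ · x ⇓ nil [ 1 ]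
  ⇓-head   : ∀ {x} → headₚ · x ⇓ head x [ 1 ]
  ⇓-tail   : ∀ {x} → tailₚ · x ⇓ tail x [ 1 ]
  ⇓-cons   : ∀ {p q x y z s t} →
             p · x ⇓ y [ s ] → q · x ⇓ z [ t ] →
             ⟨ p , q ⟩ · x ⇓ cons y z [ suc (s + t) ]
  ⇓-seq    : ∀ {p q x y z s t} →
             p · x ⇓ y [ s ] → q · y ⇓ z [ t ] →
             p ⨾ q · x ⇓ z [ suc (s + t) ]
  ⇓-then   : ∀ {b p q x a d y s t} →
             b · x ⇓ cons a d [ s ] → p · x ⇓ y [ t ] →
             if b then p else q · x ⇓ y [ suc (s + t) ]
  ⇓-else   : ∀ {b p q x y s t} →
             b · x ⇓ nil [ s ] → q · x ⇓ y [ t ] →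
             if b then p else q · x ⇓ y [ suc (s + t) ]
  ⇓-stop   : ∀ {b p x s} →
             b · x ⇓ nil [ s ] →
             while b loop p · x ⇓ x [ suc s ]
  ⇓-again  : ∀ {b p x a d y z s t u} →
             b · x ⇓ cons a d [ s ] → p · x ⇓ y [ t ] →
             while b loop p · y ⇓ z [ u ] →
             while b loop p · x ⇓ z [ suc (s + t + u) ]

PolynomialTime : ∀ {ℓ : Level} {X : Set ℓ} → Program → (X → Tree) → Set ℓ
PolynomialTime p encode =
  ∃[ a ] ∃[ d ] ∀ x → ∃[ y ] ∃[ t ]
    p · encode x ⇓ y [ t ] × t ≤ a * size (encode x) ^ d

Outputs : Program → Tree → Tree → Set
Outputs p x y = ∃[ t ] p · x ⇓ y [ t ]

encodeBool : Bool → Tree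
encodeBool false  = nil
encodeBool true   = cons nil nil

encodeList : ∀ {A : Set} → (A → Tree) → List A → Tree
encodeList e []        = nil
encodeList e (x ∷ xs)  = cons (e x) (encodeList e xs)

encodeMaybe : ∀ {A : Set} → (A → Tree) → Maybe A → Tree
encodeMaybe e nothing   = nil
encodeMaybe e (just x)  = cons nil (e x)

-- The digits of the (bijective) binary numeral, least significant first, so
-- that the encoding of a number has logarithmic size.
encodeℕᵇ : ℕᵇ → Tree
encodeℕᵇ zero      = nil
encodeℕᵇ 2[1+ x ]  = cons (encodeBool false) (encodeℕᵇ x)
encodeℕᵇ 1+[2 x ]  = cons (encodeBool true) (encodeℕᵇ x)

encodeℕ : ℕ → Tree
encodeℕ m = encodeℕᵇ (fromℕ m)

encodeFin : ∀ {m} → Fin m → Tree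
encodeFin i = encodeℕ (toℕ i)

encodeGraph : ∀ {n} → Graph n → Tree
encodeGraph {n} G =
  encodeList (λ u → encodeList (λ v → encodeBool (does (u ~? v))) (allFin n)) (allFin n)
  where open Graph G

encodeInstance : Instance → Tree
encodeInstance I =
  cons (encodeGraph graph)
    (cons (encodeℕ k)
      (cons (encodeList (λ v → encodeMaybe encodeFin (c v)) (allFin n))
        (cons (encodeℕ ∣ ↥ ρ ∣) (encodeℕ (↧ₙ ρ)))))
  where open Instance I

encodeColouring : ∀ {n k} → (Fin n → Fin k) → Tree
encodeColouring {n} c′ = encodeList (λ v → encodeFin (c′ v)) (allFin n)

_⁻³ : (m : ℕ) .{{_ : NonZero m}} → ℚ
m ⁻³ = _/_ (+ 1) (m ^ 3) {{m^n≢0 m 3}}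

{-# OPTIONS --safe #-}

-- Go through the vertices v and the colours i that occur (together with one default
-- colour).  Whenever v can still be made happy in colour i, give i to all uncoloured
-- vertices of the closed neighbourhood N[v]; v then stays happy for ever.  A vertex v
-- that is happy in some extension could have been chosen unless N[v] was touched before,
-- on behalf of some chosen v′ with N[v] ∩ N[v′] ≠ ∅.  Hence OPT ≤ (1 + Δ)² · #chosen
-- ≤ 4Δ³ · #happy.  The threshold test compares deg(v) · p with m · q for ρ = p/q: both
-- products are formed digit by digit, with carries small enough to be kept in unary.
module Submission where

open import Defs
open import Data.Bool.Base using (Bool; true; false; _∧_; _∨_; T)
  renaming (if_then_else_ to ifᵇ_then_else_)
open import Data.Bool.Properties using (∨-zeroʳ)
open import Data.Fin.Base as Fin using (Fin; toℕ; fromℕ<)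
import Data.Fin.Properties as Fin
open import Data.Integer.Base as ℤ using (∣_∣)
import Data.Integer.Properties as ℤ
open import Data.List.Base
  using (List; []; _∷_; _++_; _ʳ++_; allFin; concatMap; filter; foldl; length; map; replicate; reverse; tabulate)
open import Data.List.Extrema.Nat using (xs≤max)
open import Data.List.Membership.Propositional using (_∈_)
open import Data.List.Membership.Propositional.Properties
  using (∈-allFin; ∈-filter⁺; ∈-filter⁻; ∈-concatMap⁺; ∈-∃++; ∈-++⁻; ∈-++⁺ˡ; ∈-++⁺ʳ; ∈-map⁺)
open import Data.List.Properties
  using (foldl-++; length-++; length-replicate; length-reverse; map-tabulate; reverse-involutive)
open import Data.List.Relation.Unary.All as All using (All)
open import Data.List.Relation.Unary.AllPairs using ([]; _∷_)
open import Data.List.Relation.Unary.Any as Any using (here; there)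
open import Data.List.Relation.Unary.Unique.Propositional using (Unique)
import Data.List.Relation.Unary.Unique.Propositional.Properties as Unique
open import Data.Maybe.Base using (Maybe; just; nothing; maybe′)
open import Data.Maybe.Properties using (just-injective)
open import Data.Nat.Base
open import Data.Nat.Binary.Base using (ℕᵇ; zero; 2[1+_]; 1+[2_]; fromℕ) renaming (toℕ to ⟦_⟧)
open import Data.Nat.Binary.Properties using (toℕ-fromℕ)
open import Data.Nat.Properties
open import Data.Nat.Tactic.RingSolver using (solve-∀)
open import Data.Product.Base using (Σ; _×_; _,_; proj₁; proj₂; ∃-syntax)
open import Data.Rational.Base as ℚ using (0ℚ; ↥_; ↧ₙ_; toℚᵘ)
import Data.Rational.Properties as ℚ
open import Data.Rational.Unnormalised.Base as ℚᵘ using (mkℚᵘ)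
import Data.Rational.Unnormalised.Properties as ℚᵘ
open import Data.Sum.Base using (_⊎_; inj₁; inj₂; [_,_]′; map₁)
open import Data.Unit.Base using (tt)
open import Function.Base using (_∘_; id)
open import Function.Bundles using (_⇔_; mk⇔; Equivalence)
import Function.Properties.Equivalence as ⇔
open import Level using (Level; 0ℓ)
open import Relation.Binary.PropositionalEquality
open import Relation.Nullary using (Dec; yes; no; contradiction)
open import Relation.Nullary.Decidable using (does; does-⇔; dec-true; _×-dec_)
open import Relation.Unary using (Pred; Decidable)

-- The number `k` is given in binary and may be exponential in the input size, so the colours cannot
-- be enumerated. Those that occur suffice: if no vertex of N[v] is precoloured with the colour that
-- v has in an extension, then all vertices of N[v] sharing this colour are still free, and any
-- other colour serves them as well. The threshold is binary too, so its numerator and denominator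
-- may not be written in unary, whereas degrees and counts may. The running time must be carried
-- through nested loops by explicit derivations. A loop body needs one bound that is valid for every
-- accumulator, including those that no run reaches. So programs are indexed by a type of contexts
-- that contains the accumulators, while the measure `N` looks at the instance alone. An invariant
-- on which a time bound depends has to be part of the type of the accumulator.

private variable
  ℓ : Level
  X Y : Set ℓ
  A W : Set

-- Polynomial bounds

-- The base 2 + N x exceeds 1, so that a single power absorbs all constants.
Poly : (X → ℕ) → (X → ℕ) → Set _
Poly N T = ∃[ d ] ∀ x → T x ≤ (2 + N x) ^ d

module _ {X : Set ℓ} {N : X → ℕ} where

  poly-≤ : ∀ {S T : X → ℕ} → (∀ x → S x ≤ T x) → Poly N T → Poly N S
  poly-≤ S≤T (d , T≤) = d , λ x → ≤-trans (S≤T x) (T≤ x)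

  poly-const : ∀ m → Poly N (λ _ → m)
  poly-const m = m , λ x → ≤-trans (m≤2^m m) (^-monoˡ-≤ m (s≤s (s≤s z≤n)))
    where
    m≤2^m : ∀ m → m ≤ 2 ^ m
    m≤2^m zero    = z≤n
    m≤2^m (suc m) = begin
      1 + m          ≤⟨ +-mono-≤ (m^n>0 2 m) (m≤2^m m) ⟩
      2 ^ m + 2 ^ m  ≡⟨ cong (2 ^ m +_) (sym (+-identityʳ _)) ⟩
      2 * 2 ^ m      ∎
      where open ≤-Reasoning

  poly-* : ∀ {S T : X → ℕ} → Poly N S → Poly N T → Poly N (λ x → S x * T x)
  poly-* (c , S≤) (d , T≤) = c + d , λ x →
    ≤-trans (*-mono-≤ (S≤ x) (T≤ x)) (≤-reflexive (sym (^-distribˡ-+-* (2 + N x) c d)))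

  poly-+ : ∀ {S T : X → ℕ} → Poly N S → Poly N T → Poly N (λ x → S x + T x)
  poly-+ {S} {T} (c , S≤) (d , T≤) = suc (c + d) , λ x →
    let M = 2 + N x
        A = M ^ c
        B = M ^ d
        instance
          _ = m^n≢0 M c
          _ = m^n≢0 M d
        open ≤-Reasoning
    in begin
      S x + T x        ≤⟨ +-mono-≤ (S≤ x) (T≤ x) ⟩
      -- Both powers are at least 1, so the sum is at most twice the product. The base absorbs the
      -- 2, whence the `suc` in the exponent.
      A + B            ≤⟨ +-mono-≤ (m≤m*n A B) (m≤n*m B A) ⟩
      A * B + A * B    ≡⟨ cong (A * B +_) (sym (+-identityʳ _)) ⟩
      2 * (A * B)      ≤⟨ *-monoˡ-≤ (A * B) {2} {M} (s≤s (s≤s z≤n)) ⟩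
      M * (A * B)      ≡⟨ cong (M *_) (sym (^-distribˡ-+-* M c d)) ⟩
      M ^ suc (c + d)  ∎

  poly-suc : ∀ {T : X → ℕ} → Poly N T → Poly N (suc ∘ T)
  poly-suc = poly-+ (poly-const 1)

  poly-N : Poly N N
  poly-N = 1 , λ x → ≤-trans (m≤n+m (N x) 2) (≤-reflexive (sym (*-identityʳ _)))

-- Programs with polynomial running time

-- Only the lengths of the lists that a program runs through enter its running time, so
-- that f needs no bound on the size of its values.
record Computes {X : Set ℓ} (N : X → ℕ) (e f : X → Tree) : Set ℓ where
  constructor computes
  field
    prog : Program
    time : X → ℕ
    poly : Poly N time
    run  : ∀ x → prog · e x ⇓ f x [ time x ]

open Computes

ifᵗ_then_else_ : Tree → Tree → Tree → Tree
ifᵗ nil      then t else u = u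
ifᵗ cons _ _ then t else u = t

module _ {X : Set ℓ} {N : X → ℕ} where

  private variable
    e f g h : X → Tree

  idᶜ : Computes N e e
  idᶜ = computes idₚ _ (poly-const 1) λ _ → ⇓-id

  nilᶜ : Computes N e (λ _ → nil)
  nilᶜ = computes nilₚ _ (poly-const 1) λ _ → ⇓-nil

  infixl 5 _⨾ᶜ_
  _⨾ᶜ_ : Computes N e f → Computes N f g → Computes N e g
  p ⨾ᶜ q = computes (prog p ⨾ prog q) _ (poly-suc (poly-+ (poly p) (poly q)))
    λ x → ⇓-seq (run p x) (run q x)

  headᶜ : Computes N e f → Computes N e (head ∘ f)
  headᶜ p = p ⨾ᶜ computes headₚ _ (poly-const 1) λ _ → ⇓-head

  tailᶜ : Computes N e f → Computes N e (tail ∘ f)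
  tailᶜ p = p ⨾ᶜ computes tailₚ _ (poly-const 1) λ _ → ⇓-tail

  infixr 4 _,ᶜ_
  _,ᶜ_ : Computes N e f → Computes N e g → Computes N e (λ x → cons (f x) (g x))
  p ,ᶜ q = computes ⟨ prog p , prog q ⟩ _ (poly-suc (poly-+ (poly p) (poly q)))
    λ x → ⇓-cons (run p x) (run q x)

  ifᶜ : Computes N e f → Computes N e g → Computes N e h →
        Computes N e (λ x → ifᵗ f x then g x else h x)
  ifᶜ {e} {f} {g} {h} p q r = computes
    (if prog p then prog q else prog r)
    (λ x → suc (time p x + branch x (f x)))
    (poly-suc (poly-+ (poly p) (poly-≤ (λ x → branch≤ x (f x)) (poly-+ (poly q) (poly r)))))
    (λ x → runs x (f x) refl)
    where
    branch : X → Tree → ℕ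
    branch x nil        = time r x
    branch x (cons _ _) = time q x
    branch≤ : ∀ x t → branch x t ≤ time q x + time r x
    branch≤ x nil        = m≤n+m _ _
    branch≤ x (cons _ _) = m≤m+n _ _
    runs : ∀ x t → f x ≡ t →
           if prog p then prog q else prog r · e x ⇓ ifᵗ t then g x else h x
             [ suc (time p x + branch x t) ]
    runs x nil        eq = ⇓-else (subst (λ t → prog p · e x ⇓ t [ time p x ]) eq (run p x)) (run r x)
    runs x (cons _ _) eq = ⇓-then (subst (λ t → prog p · e x ⇓ t [ time p x ]) eq (run p x)) (run q x)

  -- Programs are built from operations on trees; this is where their values are identified with the
  -- encoded mathematical ones.
  ext : (∀ x → f x ≡ g x) → Computes N e f → Computes N e g
  ext f≗g p = computes (prog p) (time p) (poly p)
    λ x → subst (λ t → prog p · _ ⇓ t [ time p x ]) (f≗g x) (run p x)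

  -- The environment is a stack of pairs: a local variable is pushed in front, and later code
  -- reaches a variable by the number of tails before it.
  letᶜ : Computes N e f → Computes N (λ x → cons (f x) (e x)) g → Computes N e g
  letᶜ p q = (p ,ᶜ idᶜ) ⨾ᶜ q

reindex : {N : X → ℕ} {e f : X → Tree} (π : Y → X) →
          Computes N e f → Computes (N ∘ π) (e ∘ π) (f ∘ π)
reindex π p = computes (prog p) (time p ∘ π) (proj₁ (poly p) , proj₂ (poly p) ∘ π) (run p ∘ π)

module _ {X : Set ℓ} {N : X → ℕ} {e : X → Tree} {E S : X → Set}
         {encE : ∀ x → E x → Tree} {encS : ∀ x → S x → Tree}
         {step : ∀ x → S x → E x → S x} where

  -- The body is indexed by element and accumulator, but its measure is `N ∘ proj₁`. One exponent
  -- therefore bounds every iteration, and the total is the number of iterations times that bound,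
  -- however large the accumulator grows.
  foldᶜ : {L : ∀ x → List (E x)} {s₀ : ∀ x → S x} →
          Poly N (λ x → length (L x)) →
          Computes N e (λ x → encodeList (encE x) (L x)) →
          Computes N e (λ x → encS x (s₀ x)) →
          Computes {X = Σ X λ x → E x × S x} (N ∘ proj₁)
            (λ (x , a , s) → cons (encE x a) (cons (encS x s) (e x)))
            (λ (x , a , s) → encS x (step x s a)) →
          Computes N e (λ x → encS x (foldl (step x) (s₀ x) (L x)))
  foldᶜ {L} {s₀} ∣L∣ p q r = headᶜ (tailᶜ ((p ,ᶜ q ,ᶜ idᶜ) ⨾ᶜ loop))
    where
    state : ∀ x → List (E x) → S x → Tree
    state x as s = cons (encodeList (encE x) as) (cons (encS x s) (e x))

    loopTime : ∀ x → List (E x) → S x → ℕ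
    loopTime x []       s = 2
    loopTime x (a ∷ as) s =
      suc (1 + suc (3 + suc (suc (5 + time r (x , a , s)) + 3)) + loopTime x as (step x s a))

    body : Program
    body = ⟨ headₚ ⨾ tailₚ , ⟨ ⟨ headₚ ⨾ headₚ , tailₚ ⟩ ⨾ prog r , tailₚ ⨾ tailₚ ⟩ ⟩

    loopRun : ∀ x as s → while headₚ loop body · state x as s
                         ⇓ state x [] (foldl (step x) s as) [ loopTime x as s ]
    loopRun x []       s = ⇓-stop ⇓-head
    loopRun x (a ∷ as) s = ⇓-again {x = state x (a ∷ as) s} {y = state x as (step x s a)} ⇓-head
      (⇓-cons (⇓-seq {y = encodeList (encE x) (a ∷ as)} ⇓-head ⇓-tail)
        (⇓-cons
          (⇓-seq (⇓-cons (⇓-seq {y = encodeList (encE x) (a ∷ as)} ⇓-head ⇓-head) ⇓-tail)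
            (run r (x , a , s)))
          (⇓-seq {y = cons (encS x s) (e x)} ⇓-tail ⇓-tail)))
      (loopRun x as (step x s a))

    iteration-cost : ∀ t u → suc (1 + suc (3 + suc (suc (5 + t) + 3)) + u) ≡ 16 + t + u
    iteration-cost = solve-∀

    d : ℕ
    d = proj₁ (poly r)

    loopTime≤ : ∀ x as s → loopTime x as s ≤ 2 + length as * (16 + (2 + N x) ^ d)
    loopTime≤ x []       s = ≤-refl
    loopTime≤ x (a ∷ as) s = begin
      loopTime x (a ∷ as) s                        ≡⟨ iteration-cost (time r (x , a , s)) _ ⟩
      16 + time r (x , a , s) + loopTime x as _    ≤⟨ +-mono-≤ (+-monoʳ-≤ 16 (proj₂ (poly r) (x , a , s)))
                                                               (loopTime≤ x as (step x s a)) ⟩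
      B + (2 + length as * B)                      ≡⟨ shift B (length as * B) ⟩
      2 + (B + length as * B)                      ∎
      where
      open ≤-Reasoning
      B = 16 + (2 + N x) ^ d
      shift : ∀ m n → m + (2 + n) ≡ 2 + (m + n)
      shift = solve-∀

    loop : Computes N (λ x → state x (L x) (s₀ x)) (λ x → state x [] (foldl (step x) (s₀ x) (L x)))
    loop = computes (while headₚ loop body) (λ x → loopTime x (L x) (s₀ x))
      (poly-≤ (λ x → loopTime≤ x (L x) (s₀ x))
        (poly-+ (poly-const 2) (poly-* ∣L∣ (poly-+ (poly-const 16) (d , λ _ → ≤-refl)))))
      λ x → loopRun x (L x) (s₀ x)

-- Programs for Booleans and lists

trueᶜ : ∀ {X : Set ℓ} {N : X → ℕ} {e : X → Tree} → Computes N e (λ _ → encodeBool true)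
trueᶜ = nilᶜ ,ᶜ nilᶜ

andᶜ : ∀ {X : Set ℓ} {N : X → ℕ} {e : X → Tree} {a b} → Computes N e (encodeBool ∘ a) →
       Computes N e (encodeBool ∘ b) →
       Computes N e (λ x → encodeBool (a x ∧ b x))
andᶜ {a = a} p q = ext (λ x → if-∧ (a x)) (ifᶜ p q nilᶜ)
  where
  if-∧ : ∀ b {c} → ifᵗ encodeBool b then encodeBool c else nil ≡ encodeBool (b ∧ c)
  if-∧ false = refl
  if-∧ true  = refl

ifᵗ-bool : ∀ {B : Set} (enc : B → Tree) b {y z} →
           ifᵗ encodeBool b then enc y else enc z ≡ enc (ifᵇ b then y else z)
ifᵗ-bool enc false = refl
ifᵗ-bool enc true  = refl

extend : ∀ {X : Set ℓ} {N : X → ℕ} {e f : X → Tree} {S : X → Set} {s : Σ X S → Tree} →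
         Computes N e f → Computes {X = Σ X S} (N ∘ proj₁) (λ y → cons (s y) (e (proj₁ y))) (f ∘ proj₁)
extend p = tailᶜ idᶜ ⨾ᶜ reindex proj₁ p

module _ {X : Set ℓ} {N : X → ℕ} {e : X → Tree} {W : X → Set}
         {L : ∀ x → List (W x)} {encW : ∀ x → W x → Tree}
         (∣L∣ : Poly N (λ x → length (L x))) (p : Computes N e (λ x → encodeList (encW x) (L x))) where

  map-reverseᶜ : {g : ∀ x → W x → Tree} →
                 Computes {X = Σ X W} (N ∘ proj₁) (λ (x , w) → cons (encW x w) (e x)) (λ (x , w) → g x w) →
                 Computes N e (λ x → encodeList (g x) (reverse (L x)))
  map-reverseᶜ {g} q = foldᶜ {encS = λ x → encodeList (g x)} {step = λ x s w → w ∷ s} {s₀ = λ _ → []}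
    ∣L∣ p nilᶜ
    ((headᶜ idᶜ ,ᶜ tailᶜ (tailᶜ idᶜ)) ⨾ᶜ reindex (λ (x , w , s) → x , w) q ,ᶜ headᶜ (tailᶜ idᶜ))

  reverseᶜ : Computes N e (λ x → encodeList (encW x) (reverse (L x)))
  reverseᶜ = map-reverseᶜ (headᶜ idᶜ)

module _ {X : Set ℓ} {N : X → ℕ} {e : X → Tree} {W : X → Set}
         {L : ∀ x → List (W x)} {encW : ∀ x → W x → Tree}
         (∣L∣ : Poly N (λ x → length (L x))) (p : Computes N e (λ x → encodeList (encW x) (L x))) where

  -- A fold that pushes its results onto a list delivers them in reverse, so the input is reversed
  -- beforehand.
  mapᶜ : {g : ∀ x → W x → Tree} →
         Computes {X = Σ X W} (N ∘ proj₁) (λ (x , w) → cons (encW x w) (e x)) (λ (x , w) → g x w) →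
         Computes N e (λ x → encodeList (g x) (L x))
  mapᶜ {g} q = ext (λ x → cong (encodeList (g x)) (reverse-involutive (L x)))
    (reverseᶜ (poly-≤ (λ x → ≤-reflexive (length-reverse (L x))) ∣L∣) (map-reverseᶜ ∣L∣ p q))

count : (A → Bool) → List A → ℕ
count P []       = 0
count P (x ∷ xs) = ifᵇ P x then suc (count P xs) else count P xs

count≤length : (P : A → Bool) (xs : List A) → count P xs ≤ length xs
count≤length P []       = z≤n
count≤length P (x ∷ xs) with P x
... | false = m≤n⇒m≤1+n (count≤length P xs)
... | true  = s≤s (count≤length P xs)

foldl-count : (P : A → Bool) (m : ℕ) (xs : List A) →
              foldl (λ s x → ifᵇ P x then suc s else s) m xs ≡ m + count P xs
foldl-count P m []       = sym (+-identityʳ m)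
foldl-count P m (x ∷ xs) with P x
... | false = foldl-count P m xs
... | true  = trans (foldl-count P (suc m) xs) (sym (+-suc m _))

iterate : (A → A) → A → ℕ → A
iterate f x zero    = x
iterate f x (suc m) = iterate f (f x) m

unary : ℕ → Tree
unary m = encodeList (λ _ → nil) (replicate m tt)

module _ {X : Set ℓ} {N : X → ℕ} {e : X → Tree} {W : X → Set}
         {L : ∀ x → List (W x)} {encW : ∀ x → W x → Tree} {P : ∀ x → W x → Bool}
         (∣L∣ : Poly N (λ x → length (L x))) (p : Computes N e (λ x → encodeList (encW x) (L x))) where

  countᶜ : Computes {X = Σ X W} (N ∘ proj₁) (λ (x , w) → cons (encW x w) (e x)) (λ (x , w) → encodeBool (P x w)) →
           Computes N e (λ x → unary (count (P x) (L x)))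
  countᶜ q = ext (λ x → cong unary (foldl-count (P x) 0 (L x)))
    (foldᶜ {encS = λ _ → unary} {s₀ = λ _ → 0} ∣L∣ p nilᶜ
      (ext (λ (x , w , s) → ifᵗ-bool unary (P x w))
        (ifᶜ ((headᶜ idᶜ ,ᶜ tailᶜ (tailᶜ idᶜ)) ⨾ᶜ reindex (λ (x , w , s) → x , w) q)
             (nilᶜ ,ᶜ headᶜ (tailᶜ idᶜ)) (headᶜ (tailᶜ idᶜ)))))

-- The second list is an arbitrary tree. Past its end `head` and `tail` yield `nil`, so it may be
-- shorter or longer than the first, which alone governs the running time.
zipTrees : (W → Tree) → List W → Tree → List Tree
zipTrees f []       t = []
zipTrees f (w ∷ ws) t = cons (f w) (head t) ∷ zipTrees f ws (tail t)

length-zipTrees : (f : W → Tree) (ws : List W) (t : Tree) → length (zipTrees f ws t) ≡ length ws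
length-zipTrees f []       t = refl
length-zipTrees f (w ∷ ws) t = cong suc (length-zipTrees f ws (tail t))

zipTrees-encodeList : (f g : W → Tree) (ws : List W) →
  encodeList id (zipTrees f ws (encodeList g ws)) ≡ encodeList (λ w → cons (f w) (g w)) ws
zipTrees-encodeList f g []       = refl
zipTrees-encodeList f g (w ∷ ws) = cong (cons _) (zipTrees-encodeList f g ws)

module _ {X : Set ℓ} {N : X → ℕ} {e : X → Tree} {W : X → Set}
         {L : ∀ x → List (W x)} {encW : ∀ x → W x → Tree} {t : X → Tree}
         (∣L∣ : Poly N (λ x → length (L x))) (p : Computes N e (λ x → encodeList (encW x) (L x))) where

  zipᶜ : Computes N e t → Computes N e (λ x → encodeList id (zipTrees (encW x) (L x) (t x)))
  zipᶜ q = ext (λ x → cong (encodeList id) (reverse-involutive (zipped x)))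
    (reverseᶜ
      (poly-≤ (λ x → ≤-reflexive (trans (length-reverse (zipped x)) (length-zipTrees _ (L x) (t x)))) ∣L∣)
      (ext (λ x → cong (encodeList id) (foldl-zip x (L x) (t x) []))
        (tailᶜ (foldᶜ {encS = encS} {step = step} {s₀ = λ x → t x , []} ∣L∣ p (q ,ᶜ nilᶜ)
          (tailᶜ (headᶜ (headᶜ (tailᶜ idᶜ))) ,ᶜ (headᶜ idᶜ ,ᶜ headᶜ (headᶜ (headᶜ (tailᶜ idᶜ)))) ,ᶜ
           tailᶜ (headᶜ (tailᶜ idᶜ)))))))
    where
    zipped : X → List Tree
    zipped x = zipTrees (encW x) (L x) (t x)
    encS : X → Tree × List Tree → Tree
    encS _ (u , us) = cons u (encodeList id us)
    step : ∀ x → Tree × List Tree → W x → Tree × List Tree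
    step x (u , us) w = tail u , cons (encW x w) (head u) ∷ us
    foldl-zip : ∀ x ws u us →
      proj₂ (foldl (step x) (u , us) ws) ≡ zipTrees (encW x) ws u ʳ++ us
    foldl-zip x []       u us = refl
    foldl-zip x (w ∷ ws) u us = foldl-zip x ws (tail u) (cons (encW x w) (head u) ∷ us)

-- Unary and binary numbers

module _ {X : Set ℓ} {N : X → ℕ} {e : X → Tree} {S : X → Set}
         {encS : ∀ x → S x → Tree} {step : ∀ x → S x → S x} where

  iterateᶜ : {m : X → ℕ} {s₀ : ∀ x → S x} → Poly N m → Computes N e (unary ∘ m) →
             Computes N e (λ x → encS x (s₀ x)) →
             Computes {X = Σ X S} (N ∘ proj₁) (λ (x , s) → cons (encS x s) (e x)) (λ (x , s) → encS x (step x s)) →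
             Computes N e (λ x → encS x (iterate (step x) (s₀ x) (m x)))
  iterateᶜ {m} ∣m∣ p q r = ext (λ x → cong (encS x) (foldl-iterate (step x) _ (m x)))
    (foldᶜ {encS = encS} (poly-≤ (λ x → ≤-reflexive (length-replicate (m x))) ∣m∣) p q
      (tailᶜ idᶜ ⨾ᶜ reindex (λ (x , _ , s) → x , s) r))
    where
    foldl-iterate : ∀ {S : Set} (f : S → S) s m → foldl (λ s _ → f s) s (replicate m tt) ≡ iterate f s m
    foldl-iterate f s zero    = refl
    foldl-iterate f s (suc m) = foldl-iterate f (f s) m

iterate-+ : ∀ c a m → iterate (c +_) a m ≡ a + m * c
iterate-+ c a zero    = sym (+-identityʳ a)
iterate-+ c a (suc m) = trans (iterate-+ c (c + a) m) (rearrange c a (m * c))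
  where
  rearrange : ∀ c a b → c + a + b ≡ a + (c + b)
  rearrange = solve-∀

iterate-pred : ∀ a m → iterate pred a m ≡ a ∸ m
iterate-pred a       zero    = refl
iterate-pred zero    (suc m) = trans (iterate-pred zero m) (0∸n≡0 m)
iterate-pred (suc a) (suc m) = iterate-pred a m

-- Adding 1 turns the rounded-up half into the rounded-down one, and the old rounded-down half plus
-- 1 into the rounded-up one. Halving is thus a loop of swaps.
iterate-halves : ∀ a m → iterate (λ (f , c) → c , suc f) (⌊ a /2⌋ , ⌈ a /2⌉) m ≡ (⌊ m + a /2⌋ , ⌈ m + a /2⌉)
iterate-halves a zero    = refl
iterate-halves a (suc m) = trans (iterate-halves (suc a) m) (cong (λ b → ⌊ b /2⌋ , ⌈ b /2⌉) (+-suc m a))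

module _ {X : Set ℓ} {N : X → ℕ} {e : X → Tree} {a b : X → ℕ} where

  monusᶜ : Poly N b → Computes N e (unary ∘ a) → Computes N e (unary ∘ b) →
           Computes N e (λ x → unary (a x ∸ b x))
  monusᶜ ∣b∣ p q = ext (λ x → cong unary (iterate-pred (a x) (b x)))
    (iterateᶜ {encS = λ _ → unary} ∣b∣ q p (ext (λ (x , m) → tail-unary m) (tailᶜ (headᶜ idᶜ))))
    where
    tail-unary : ∀ m → tail (unary m) ≡ unary (pred m)
    tail-unary zero    = refl
    tail-unary (suc m) = refl

  leqᶜ : Poly N b → Computes N e (unary ∘ a) → Computes N e (unary ∘ b) →
         Computes N e (λ x → encodeBool (does (a x ≤? b x)))
  leqᶜ ∣b∣ p q = ext (λ x → ∸-test (a x) (b x)) (ifᶜ (monusᶜ ∣b∣ p q) nilᶜ trueᶜ)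
    where
    ∸-test : ∀ a b → ifᵗ unary (a ∸ b) then nil else encodeBool true ≡ encodeBool (does (a ≤? b))
    ∸-test zero    zero    = refl
    ∸-test zero    (suc b) = refl
    ∸-test (suc a) zero    = refl
    ∸-test (suc a) (suc b) = trans (∸-test a b) (cong encodeBool (does-⇔ (mk⇔ s≤s s≤s⁻¹) (a ≤? b) (suc a ≤? suc b)))

module _ {X : Set ℓ} {N : X → ℕ} {e : X → Tree} {a : X → ℕ}
         (∣a∣ : Poly N a) (p : Computes N e (unary ∘ a)) where

  halvesᶜ : Computes N e (λ x → cons (unary ⌊ a x /2⌋) (unary ⌈ a x /2⌉))
  halvesᶜ = ext (λ x → cong encS (trans (iterate-halves 0 (a x)) (cong (λ b → ⌊ b /2⌋ , ⌈ b /2⌉) (+-identityʳ (a x)))))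
    (iterateᶜ {encS = λ _ → encS} {s₀ = λ _ → 0 , 0} ∣a∣ p (nilᶜ ,ᶜ nilᶜ)
      (tailᶜ (headᶜ idᶜ) ,ᶜ nilᶜ ,ᶜ headᶜ (headᶜ idᶜ)))
    where
    encS : ℕ × ℕ → Tree
    encS (f , c) = cons (unary f) (unary c)

-- In the bijective numeral the digits are 1 and 2. The digit 0 arises only past the end, so that
-- the shorter of two numerals can be read on as if padded.
digit : ℕᵇ → ℕ
digit zero     = 0
digit 2[1+ _ ] = 2
digit 1+[2 _ ] = 1

shift : ℕᵇ → ℕᵇ
shift zero     = zero
shift 2[1+ b ] = b
shift 1+[2 b ] = b

bits : ℕᵇ → List Bool
bits zero     = []
bits 2[1+ b ] = false ∷ bits b
bits 1+[2 b ] = true ∷ bits b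

∣_∣ᵇ : ℕᵇ → ℕ
∣ b ∣ᵇ = length (bits b)

encodeList-bits : ∀ b → encodeList encodeBool (bits b) ≡ encodeℕᵇ b
encodeList-bits zero     = refl
encodeList-bits 2[1+ b ] = cong (cons _) (encodeList-bits b)
encodeList-bits 1+[2 b ] = cong (cons _) (encodeList-bits b)

digit+shift : ∀ b → ⟦ b ⟧ ≡ digit b + 2 * ⟦ shift b ⟧
digit+shift zero     = refl
digit+shift 2[1+ b ] = *-suc 2 ⟦ b ⟧
digit+shift 1+[2 b ] = refl

digit≤2 : ∀ b → digit b ≤ 2
digit≤2 zero     = z≤n
digit≤2 2[1+ b ] = ≤-refl
digit≤2 1+[2 b ] = s≤s z≤n

-- A colour is smaller than `k`; this bounds its number of digits by that of `k`, hence by the input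
-- size.
∣∣ᵇ-mono : ∀ a b → ⟦ a ⟧ ≤ ⟦ b ⟧ → ∣ a ∣ᵇ ≤ ∣ b ∣ᵇ
∣∣ᵇ-mono zero     b        a≤b = z≤n
∣∣ᵇ-mono 2[1+ a ] zero     ()
∣∣ᵇ-mono 1+[2 a ] zero     ()
∣∣ᵇ-mono 2[1+ a ] 2[1+ b ] a≤b = s≤s (∣∣ᵇ-mono a b (s≤s⁻¹ (*-cancelˡ-≤ 2 a≤b)))
∣∣ᵇ-mono 2[1+ a ] 1+[2 b ] a≤b = s≤s (∣∣ᵇ-mono a b (*-cancelˡ-≤ 2
  (s≤s⁻¹ (≤-trans (≤-trans (n≤1+n _) (≤-reflexive (sym (*-suc 2 ⟦ a ⟧)))) a≤b))))
∣∣ᵇ-mono 1+[2 a ] 2[1+ b ] a≤b = s≤s (∣∣ᵇ-mono a b (s≤s⁻¹ (*-cancelˡ-< 2 _ _ a≤b)))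
∣∣ᵇ-mono 1+[2 a ] 1+[2 b ] a≤b = s≤s (∣∣ᵇ-mono a b (*-cancelˡ-≤ 2 (s≤s⁻¹ a≤b)))

⌊m+2n/2⌋ : ∀ m n → ⌊ m + 2 * n /2⌋ ≡ ⌊ m /2⌋ + n
⌊m+2n/2⌋ m zero    = trans (cong ⌊_/2⌋ (+-identityʳ m)) (sym (+-identityʳ _))
⌊m+2n/2⌋ m (suc n) = begin
  ⌊ m + 2 * suc n /2⌋      ≡⟨ cong ⌊_/2⌋ (rearrange m n) ⟩
  suc ⌊ m + 2 * n /2⌋      ≡⟨ cong suc (⌊m+2n/2⌋ m n) ⟩
  suc (⌊ m /2⌋ + n)        ≡⟨ sym (+-suc _ n) ⟩
  ⌊ m /2⌋ + suc n          ∎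
  where
  open ≡-Reasoning
  rearrange : ∀ m n → m + 2 * suc n ≡ 2 + (m + 2 * n)
  rearrange = solve-∀

2⌊m/2⌋≤m : ∀ m → 2 * ⌊ m /2⌋ ≤ m
2⌊m/2⌋≤m m = begin
  2 * ⌊ m /2⌋           ≡⟨ cong (⌊ m /2⌋ +_) (+-identityʳ _) ⟩
  ⌊ m /2⌋ + ⌊ m /2⌋     ≤⟨ +-monoʳ-≤ _ (⌊n/2⌋≤⌈n/2⌉ m) ⟩
  ⌊ m /2⌋ + ⌈ m /2⌉     ≡⟨ ⌊n/2⌋+⌈n/2⌉≡n m ⟩
  m                     ∎
  where open ≤-Reasoning

m≤2⌈m/2⌉ : ∀ m → m ≤ 2 * ⌈ m /2⌉
m≤2⌈m/2⌉ m = begin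
  m                     ≡⟨ sym (⌊n/2⌋+⌈n/2⌉≡n m) ⟩
  ⌊ m /2⌋ + ⌈ m /2⌉     ≤⟨ +-monoˡ-≤ _ (⌊n/2⌋≤⌈n/2⌉ m) ⟩
  ⌈ m /2⌉ + ⌈ m /2⌉     ≡⟨ cong (⌈ m /2⌉ +_) (sym (+-identityʳ _)) ⟩
  2 * ⌈ m /2⌉           ∎
  where open ≤-Reasoning

-- Doubling has rounding down as right adjoint and, in the next lemma, rounding up as left adjoint.
-- So halving both sides with these roundings loses no information.
2m≤n+2o⇔ : ∀ m n o → 2 * m ≤ n + 2 * o ⇔ m ≤ ⌊ n /2⌋ + o
2m≤n+2o⇔ m n o = mk⇔
  (λ le → subst₂ _≤_ (⌊m+2n/2⌋ 0 m) (⌊m+2n/2⌋ n o) (⌊n/2⌋-mono le))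
  (λ le → begin
    2 * m                  ≤⟨ *-monoʳ-≤ 2 le ⟩
    2 * (⌊ n /2⌋ + o)      ≡⟨ *-distribˡ-+ 2 ⌊ n /2⌋ o ⟩
    2 * ⌊ n /2⌋ + 2 * o    ≤⟨ +-monoˡ-≤ (2 * o) (2⌊m/2⌋≤m n) ⟩
    n + 2 * o              ∎)
  where open ≤-Reasoning

n+2m≤2o⇔ : ∀ m n o → n + 2 * m ≤ 2 * o ⇔ ⌈ n /2⌉ + m ≤ o
n+2m≤2o⇔ m n o = mk⇔
  (λ le → subst₂ _≤_ (⌊m+2n/2⌋ (suc n) m) (⌊m+2n/2⌋ 1 o) (⌈n/2⌉-mono le))
  (λ le → begin
    n + 2 * m              ≤⟨ +-monoˡ-≤ (2 * m) (m≤2⌈m/2⌉ n) ⟩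
    2 * ⌈ n /2⌉ + 2 * m    ≡⟨ sym (*-distribˡ-+ 2 ⌈ n /2⌉ m) ⟩
    2 * (⌈ n /2⌉ + m)      ≤⟨ *-monoʳ-≤ 2 le ⟩
    2 * o                  ∎)
  where open ≤-Reasoning

-- The comparison cancels the smaller of the two carries before halving, so that
-- only the one that survives has to be rounded (up on the left, down on the right).
halve-≤ : ∀ x y r s → x + 2 * r ≤ y + 2 * s ⇔ ⌈ x ∸ y /2⌉ + r ≤ ⌊ y ∸ x /2⌋ + s
halve-≤ x y r s with ≤-total x y
... | inj₁ x≤y rewrite m≤n⇒m∸n≡0 x≤y = ⇔.trans
  (mk⇔ (λ le → +-cancelˡ-≤ x _ _ (≤-trans le (≤-reflexive split)))
       (λ le → ≤-trans (+-monoʳ-≤ x le) (≤-reflexive (sym split))))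
  (2m≤n+2o⇔ r (y ∸ x) s)
  where
  split : y + 2 * s ≡ x + (y ∸ x + 2 * s)
  split = trans (cong (_+ 2 * s) (sym (m+[n∸m]≡n x≤y))) (+-assoc x _ _)
... | inj₂ y≤x rewrite m≤n⇒m∸n≡0 y≤x = ⇔.trans
  (mk⇔ (λ le → +-cancelˡ-≤ y _ _ (≤-trans (≤-reflexive (sym split)) le))
       (λ le → ≤-trans (≤-reflexive split) (+-monoʳ-≤ y le)))
  (n+2m≤2o⇔ r (x ∸ y) s)
  where
  split : x + 2 * r ≡ y + (x ∸ y + 2 * r)
  split = trans (cong (_+ 2 * r) (sym (m+[n∸m]≡n y≤x))) (+-assoc y _ _)

-- Comparing two products digit by digit

module _ {X : Set ℓ} {N : X → ℕ} {e : X → Tree} {P : X → ℕᵇ} where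

  addDigitsᶜ : {m a : X → ℕ} → Poly N m → Computes N e (unary ∘ m) → Computes N e (encodeℕᵇ ∘ P) →
               Computes N e (unary ∘ a) → Computes N e (λ x → unary (a x + m x * digit (P x)))
  addDigitsᶜ {m} {a} ∣m∣ p q r = ext (λ x → cong unary (iterate-+ (digit (P x)) (a x) (m x)))
    (iterateᶜ {encS = λ _ → unary} ∣m∣ p r
      (ext (λ (x , s) → digit-+ (P x) s)
        (ifᶜ (extend q) (ifᶜ (headᶜ (extend q)) (nilᶜ ,ᶜ s) (nilᶜ ,ᶜ nilᶜ ,ᶜ s)) s)))
    where
    s : ∀ {X : Set ℓ} {N : X → ℕ} {e : X → Tree} → Computes N e (head ∘ e)
    s = headᶜ idᶜ
    digit-+ : ∀ b s → ifᵗ encodeℕᵇ b then (ifᵗ head (encodeℕᵇ b) then cons nil (unary s)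
                        else cons nil (cons nil (unary s))) else unary s ≡ unary (digit b + s)
    digit-+ zero     s = refl
    digit-+ 2[1+ b ] s = refl
    digit-+ 1+[2 b ] s = refl

  shiftᶜ : Computes N e (encodeℕᵇ ∘ P) → Computes N e (encodeℕᵇ ∘ shift ∘ P)
  shiftᶜ p = ext (tail-shift ∘ P) (tailᶜ p)
    where
    tail-shift : ∀ b → tail (encodeℕᵇ b) ≡ encodeℕᵇ (shift b)
    tail-shift zero     = refl
    tail-shift 2[1+ b ] = refl
    tail-shift 1+[2 b ] = refl

-- Both products are read off from the least significant digit upwards: in the state
-- (p , q , a , b) the comparison still to be made is a + m p ≤ b + n q.
module Comparison (m n : ℕ) where

  -- The bounds on the carries belong to the type because the time of a round must be polynomial at
  -- every state. The value `2 * m` reproduces itself: with a digit of at most 2, the new carry is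
  -- at most half of 2m + 2m.
  State : Set
  State = Σ (ℕᵇ × ℕᵇ × ℕ × ℕ) λ (_ , _ , a , b) → a ≤ 2 * m × b ≤ 2 * n

  Holds : State → Set
  Holds ((p , q , a , b) , _) = a + m * ⟦ p ⟧ ≤ b + n * ⟦ q ⟧

  next : State → State
  next ((p , q , a , b) , a≤ , b≤) =
    let x = a + m * digit p
        y = b + n * digit q
    in (shift p , shift q , ⌈ x ∸ y /2⌉ , ⌊ y ∸ x /2⌋) ,
       ≤-trans (⌈n/2⌉-mono (m∸n≤m x y)) (bound m a p a≤) ,
       ≤-trans (⌊n/2⌋≤⌈n/2⌉ (y ∸ x)) (≤-trans (⌈n/2⌉-mono (m∸n≤m y x)) (bound n b q b≤))
    where
    bound : ∀ m a p → a ≤ 2 * m → ⌈ a + m * digit p /2⌉ ≤ 2 * m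
    bound m a p a≤ = begin
      ⌈ a + m * digit p /2⌉   ≤⟨ ⌈n/2⌉-mono (+-mono-≤ a≤ (*-monoʳ-≤ m (digit≤2 p))) ⟩
      ⌈ 2 * m + m * 2 /2⌉     ≡⟨ cong ⌈_/2⌉ (double m) ⟩
      ⌈ 2 * m + 2 * m /2⌉     ≡⟨ sym (n≡⌈n+n/2⌉ (2 * m)) ⟩
      2 * m                   ∎
      where
      open ≤-Reasoning
      double : ∀ m → 2 * m + m * 2 ≡ 2 * m + 2 * m
      double = solve-∀

  next-Holds : ∀ s → Holds s ⇔ Holds (next s)
  next-Holds ((p , q , a , b) , _) = ⇔.trans
    (mk⇔ (subst₂ _≤_ (split m a p) (split n b q)) (subst₂ _≤_ (sym (split m a p)) (sym (split n b q))))
    (halve-≤ (a + m * digit p) (b + n * digit q) (m * ⟦ shift p ⟧) (n * ⟦ shift q ⟧))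
    where
    split : ∀ m a p → a + m * ⟦ p ⟧ ≡ a + m * digit p + 2 * (m * ⟦ shift p ⟧)
    split m a p = trans (cong (λ b → a + m * b) (digit+shift p)) (distribute a m (digit p) ⟦ shift p ⟧)
      where
      distribute : ∀ a m c d → a + m * (c + 2 * d) ≡ a + m * c + 2 * (m * d)
      distribute = solve-∀

  run-Holds : ∀ (ds : List Bool) s → Holds s ⇔ Holds (foldl (λ s _ → next s) s ds)
  run-Holds []       s = ⇔.refl
  run-Holds (_ ∷ ds) s = ⇔.trans (next-Holds s) (run-Holds ds (next s))

  -- The selector `π` stands for either of the two numerals; each round removes one digit from it.
  exhausted : (π : State → ℕᵇ) → (∀ s → π (next s) ≡ shift (π s)) →
              ∀ (ds : List Bool) s → ∣ π s ∣ᵇ ≤ length ds → ⟦ π (foldl (λ s _ → next s) s ds) ⟧ ≡ 0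
  exhausted π π-next []       s ∣s∣≤ with π s | ∣s∣≤
  ... | zero     | _  = refl
  exhausted π π-next (_ ∷ ds) s ∣s∣≤ =
    exhausted π π-next ds (next s) (≤-trans (≤-reflexive (cong ∣_∣ᵇ (π-next s))) (shifted (π s) ∣s∣≤))
    where
    shifted : ∀ b {l} → ∣ b ∣ᵇ ≤ suc l → ∣ shift b ∣ᵇ ≤ l
    shifted zero     _  = z≤n
    shifted 2[1+ b ] le = s≤s⁻¹ le
    shifted 1+[2 b ] le = s≤s⁻¹ le

  start : ℕᵇ → ℕᵇ → State
  start p q = (p , q , 0 , 0) , z≤n , z≤n

  -- The bits serve only as a clock. The sum of both lengths is enough to exhaust either numeral,
  -- and then the comparison of the carries is all that remains.
  finish : ℕᵇ → ℕᵇ → State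
  finish p q = foldl (λ s _ → next s) (foldl (λ s _ → next s) (start p q) (bits p)) (bits q)

  finish⇔ : ∀ p q → let ((_ , _ , a , b) , _) = finish p q in m * ⟦ p ⟧ ≤ n * ⟦ q ⟧ ⇔ a ≤ b
  finish⇔ p q rewrite sym (foldl-++ (λ s _ → next s) (start p q) (bits p) (bits q)) =
    let ds  = bits p ++ bits q
        s   = start p q
        (_ , _ , a , b) = proj₁ (foldl (λ s _ → next s) s ds)
        ∣p∣≤ = ≤-trans (m≤m+n _ _) (≤-reflexive (sym (length-++ (bits p))))
        ∣q∣≤ = ≤-trans (m≤n+m _ ∣ p ∣ᵇ) (≤-reflexive (sym (length-++ (bits p))))
        vanish : ∀ m a {c} → c ≡ 0 → a + m * c ≡ a
        vanish m a c≡0 = trans (cong (λ c → a + m * c) c≡0) (trans (cong (a +_) (*-zeroʳ m)) (+-identityʳ a))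
        eqₐ = vanish m a (exhausted (proj₁ ∘ proj₁) (λ _ → refl) ds s ∣p∣≤)
        eqᵦ = vanish n b (exhausted (proj₁ ∘ proj₂ ∘ proj₁) (λ _ → refl) ds s ∣q∣≤)
    in ⇔.trans (run-Holds ds s) (mk⇔ (subst₂ _≤_ eqₐ eqᵦ) (subst₂ _≤_ (sym eqₐ) (sym eqᵦ)))

module _ {X : Set ℓ} {N : X → ℕ} {e : X → Tree} {m n : X → ℕ} {P Q : X → ℕᵇ}
         (∣m∣ : Poly N m) (∣n∣ : Poly N n) (∣P∣ : Poly N (∣_∣ᵇ ∘ P)) (∣Q∣ : Poly N (∣_∣ᵇ ∘ Q))
         (mᶜ : Computes N e (unary ∘ m)) (nᶜ : Computes N e (unary ∘ n))
         (Pᶜ : Computes N e (encodeℕᵇ ∘ P)) (Qᶜ : Computes N e (encodeℕᵇ ∘ Q)) where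

  *-≤ᶜ : Computes N e (λ x → encodeBool (does (m x * ⟦ P x ⟧ ≤? n x * ⟦ Q x ⟧)))
  *-≤ᶜ = ext (λ x → cong encodeBool (does-⇔ (⇔.sym (C.finish⇔ x (P x) (Q x))) (_ ≤? _) (_ ≤? _)))
    (finishᶜ ⨾ᶜ leqᶜ (poly-≤ (λ x → proj₂ (proj₂ (C.finish x (P x) (Q x)))) (poly-* (poly-const 2) ∣n∣))
      (headᶜ (tailᶜ (tailᶜ idᶜ))) (tailᶜ (tailᶜ (tailᶜ idᶜ))))
    where
    module C (x : X) = Comparison (m x) (n x)

    encS : ∀ x → C.State x → Tree
    encS x ((p , q , a , b) , _) = cons (encodeℕᵇ p) (cons (encodeℕᵇ q) (cons (unary a) (unary b)))

    nextᶜ : Computes {X = Σ X λ x → Bool × C.State x} (N ∘ proj₁)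
              (λ (x , a , s) → cons (encodeBool a) (cons (encS x s) (e x)))
              (λ (x , a , s) → encS x (C.next x s))
    nextᶜ = letᶜ {f = λ (x , _ , (p , q , a , b) , _) → unary (a + m x * digit p)}
        (addDigitsᶜ ∣m∣′ mᶜ′ (headᶜ s) (headᶜ (tailᶜ (tailᶜ s))))
        (letᶜ {f = λ (x , _ , (p , q , a , b) , _) → unary (b + n x * digit q)}
          (addDigitsᶜ ∣n∣′ (tailᶜ idᶜ ⨾ᶜ nᶜ′) (headᶜ (tailᶜ s′)) (tailᶜ (tailᶜ (tailᶜ s′))))
          (shiftᶜ (headᶜ s″) ,ᶜ shiftᶜ (headᶜ (tailᶜ s″)) ,ᶜ
           tailᶜ (monusᶜ ∣y∣ xᶜ yᶜ ⨾ᶜ halvesᶜ (poly-≤ (λ y → m∸n≤m (xᶠ y) (yᶠ y)) ∣x∣) idᶜ) ,ᶜ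
           headᶜ (monusᶜ ∣x∣ yᶜ xᶜ ⨾ᶜ halvesᶜ (poly-≤ (λ y → m∸n≤m (yᶠ y) (xᶠ y)) ∣y∣) idᶜ)))
      where
      Z = Σ X λ x → Bool × C.State x
      N′ = λ (y : Z) → N (proj₁ y)
      ∣m∣′ : Poly N′ (m ∘ proj₁)
      ∣m∣′ = proj₁ ∣m∣ , proj₂ ∣m∣ ∘ proj₁
      ∣n∣′ : Poly N′ (n ∘ proj₁)
      ∣n∣′ = proj₁ ∣n∣ , proj₂ ∣n∣ ∘ proj₁
      mᶜ′ = tailᶜ (tailᶜ idᶜ) ⨾ᶜ reindex proj₁ mᶜ
      nᶜ′ = tailᶜ (tailᶜ idᶜ) ⨾ᶜ reindex proj₁ nᶜ
      s : ∀ {X : Set ℓ} {N : X → ℕ} {e : X → Tree} → Computes N e (head ∘ tail ∘ e)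
      s = headᶜ (tailᶜ idᶜ)
      s′ : ∀ {X : Set ℓ} {N : X → ℕ} {e : X → Tree} → Computes N e (head ∘ tail ∘ tail ∘ e)
      s′ = headᶜ (tailᶜ (tailᶜ idᶜ))
      s″ : ∀ {X : Set ℓ} {N : X → ℕ} {e : X → Tree} → Computes N e (head ∘ tail ∘ tail ∘ tail ∘ e)
      s″ = headᶜ (tailᶜ (tailᶜ (tailᶜ idᶜ)))
      xᶜ : ∀ {X : Set ℓ} {N : X → ℕ} {e : X → Tree} → Computes N e (head ∘ tail ∘ e)
      xᶜ = headᶜ (tailᶜ idᶜ)
      yᶜ : ∀ {X : Set ℓ} {N : X → ℕ} {e : X → Tree} → Computes N e (head ∘ e)
      yᶜ = headᶜ idᶜ
      xᶠ yᶠ : Z → ℕ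
      xᶠ (x , _ , (p , q , a , b) , _) = a + m x * digit p
      yᶠ (x , _ , (p , q , a , b) , _) = b + n x * digit q
      ∣x∣ : Poly N′ xᶠ
      ∣x∣ = poly-+ (poly-≤ (λ (_ , _ , _ , a≤ , _) → a≤) (poly-* (poly-const 2) ∣m∣′))
                   (poly-* ∣m∣′ (poly-≤ (λ (_ , _ , (p , _) , _) → digit≤2 p) (poly-const 2)))
      ∣y∣ : Poly N′ yᶠ
      ∣y∣ = poly-+ (poly-≤ (λ (_ , _ , _ , _ , b≤) → b≤) (poly-* (poly-const 2) ∣n∣′))
                   (poly-* ∣n∣′ (poly-≤ (λ (_ , _ , (_ , q , _) , _) → digit≤2 q) (poly-const 2)))

    roundᶜ : ∀ {B : X → ℕᵇ} {s₀ : ∀ x → C.State x} → Poly N (∣_∣ᵇ ∘ B) → Computes N e (encodeℕᵇ ∘ B) →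
             Computes N e (λ x → encS x (s₀ x)) →
             Computes N e (λ x → encS x (foldl (λ s _ → C.next x s) (s₀ x) (bits (B x))))
    roundᶜ {B} ∣B∣ p q = foldᶜ {encS = encS} ∣B∣ (ext (λ x → sym (encodeList-bits (B x))) p) q nextᶜ

    finishᶜ : Computes N e (λ x → encS x (C.finish x (P x) (Q x)))
    finishᶜ = roundᶜ ∣Q∣ Qᶜ (roundᶜ ∣P∣ Pᶜ (Pᶜ ,ᶜ Qᶜ ,ᶜ nilᶜ ,ᶜ nilᶜ))

-- The greedy algorithm

∧-true⁻ : ∀ {a b} → a ∧ b ≡ true → a ≡ true × b ≡ true
∧-true⁻ {true} {true} refl = refl , refl

∧-monoʳ : ∀ a {b c} → (a ≡ true → b ≡ true → c ≡ true) → a ∧ b ≡ true → a ∧ c ≡ true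
∧-monoʳ true f b≡true = f refl b≡true

does-true : ∀ {P : Set} (P? : Dec P) → does P? ≡ true → P
does-true (yes p) refl = p

≡ᵇ-true : ∀ m n → (m ≡ᵇ n) ≡ true → m ≡ n
≡ᵇ-true m n eq = ≡ᵇ⇒≡ m n (subst T (sym eq) _)

≡ᵇ-refl : ∀ m → (m ≡ᵇ m) ≡ true
≡ᵇ-refl zero    = refl
≡ᵇ-refl (suc m) = ≡ᵇ-refl m

-- Replaces a case distinction on an existential statement for which no decision procedure is at
-- hand, such as one about `Sealed`, which quantifies over all colourings.
choose : ∀ {n} {P Q : Fin n → Set} → (∀ i → P i ⊎ Q i) → (∀ i → P i) ⊎ (∃[ i ] Q i)
choose {zero}  f = inj₁ λ ()
choose {suc n} f with f Fin.zero | choose (f ∘ Fin.suc)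
... | inj₂ q | _            = inj₂ (Fin.zero , q)
... | inj₁ p | inj₂ (i , q) = inj₂ (Fin.suc i , q)
... | inj₁ p | inj₁ ps      = inj₁ λ { Fin.zero → p ; (Fin.suc i) → ps i }

count-cong : {P Q : A → Bool} → (∀ x → P x ≡ Q x) → ∀ xs → count P xs ≡ count Q xs
count-cong P≗Q []       = refl
count-cong {Q = Q} P≗Q (x ∷ xs) rewrite P≗Q x | count-cong P≗Q xs = refl

count-mono : {P Q : A → Bool} → (∀ x → P x ≡ true → Q x ≡ true) → ∀ xs → count P xs ≤ count Q xs
count-mono P⇒Q []       = z≤n
count-mono {P = P} {Q} P⇒Q (x ∷ xs) with P x in eq
... | true  rewrite P⇒Q x eq = s≤s (count-mono P⇒Q xs)
... | false with Q x
...   | true  = m≤n⇒m≤1+n (count-mono P⇒Q xs)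
...   | false = count-mono P⇒Q xs

count>0⁻ : (P : A → Bool) (xs : List A) → 1 ≤ count P xs → ∃[ x ] P x ≡ true
count>0⁻ P (x ∷ xs) le with P x in eq
... | true  = x , eq
... | false = count>0⁻ P xs le

count>0⁺ : (P : A → Bool) {x : A} {xs : List A} → x ∈ xs → P x ≡ true → 1 ≤ count P xs
count>0⁺ P (here refl) eq rewrite eq = s≤s z≤n
count>0⁺ P {xs = y ∷ _} (there x∈) eq with P y
... | true  = s≤s z≤n
... | false = count>0⁺ P x∈ eq

length-filter≡count : {P : Pred A 0ℓ} (P? : Decidable P) (xs : List A) →
                      length (filter P? xs) ≡ count (does ∘ P?) xs
length-filter≡count P? []       = refl
length-filter≡count P? (x ∷ xs) with does (P? x)
... | true  = cong suc (length-filter≡count P? xs)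
... | false = length-filter≡count P? xs

length-unique-⊆ : {xs ys : List A} → Unique xs → (∀ {x} → x ∈ xs → x ∈ ys) → length xs ≤ length ys
length-unique-⊆ {xs = []}     []            ⊆ys = z≤n
length-unique-⊆ {xs = x ∷ xs} (x∉xs ∷ uniq) ⊆ys with ∈-∃++ (⊆ys (here refl))
... | as , bs , refl = begin
  suc (length xs)           ≤⟨ s≤s (length-unique-⊆ uniq avoid) ⟩
  suc (length (as ++ bs))   ≡⟨ cong suc (length-++ as) ⟩
  suc (length as + length bs) ≡⟨ sym (+-suc _ _) ⟩
  length as + length (x ∷ bs) ≡⟨ sym (length-++ as) ⟩
  length (as ++ x ∷ bs)     ∎
  where
  open ≤-Reasoning
  avoid : ∀ {y} → y ∈ xs → y ∈ as ++ bs
  avoid y∈xs with ∈-++⁻ as (⊆ys (there y∈xs))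
  ... | inj₁ y∈as           = ∈-++⁺ˡ y∈as
  ... | inj₂ (here refl)    = contradiction refl (All.lookup x∉xs y∈xs)
  ... | inj₂ (there y∈bs)   = ∈-++⁺ʳ as y∈bs

length-concatMap≤ : ∀ {B : Set} (f : A → List B) {b} → (∀ x → length (f x) ≤ b) → ∀ xs →
                    length (concatMap f xs) ≤ length xs * b
length-concatMap≤ f f≤b []       = z≤n
length-concatMap≤ f f≤b (x ∷ xs) = ≤-trans (≤-reflexive (length-++ (f x)))
  (+-mono-≤ (f≤b x) (length-concatMap≤ f f≤b xs))

-- The threshold as an inequality between natural numbers

toℚᵘ-/1 : ∀ m → toℚᵘ (ℤ.+ m ℚ./ 1) ℚᵘ.≃ mkℚᵘ (ℤ.+ m) 0
toℚᵘ-/1 m = ℚ.toℚᵘ-fromℚᵘ (mkℚᵘ (ℤ.+ m) 0)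

-- The rational enters through some fraction equivalent to it. This covers both ρ in lowest terms
-- and the final factor 1/(4Δ³), whose normal form is never computed.
*-≤-/1 : ∀ r p q-1 → toℚᵘ r ℚᵘ.≃ mkℚᵘ (ℤ.+ p) q-1 → ∀ m n →
         r ℚ.* (ℤ.+ m ℚ./ 1) ℚ.≤ ℤ.+ n ℚ./ 1 ⇔ m * p ≤ n * suc q-1
*-≤-/1 r p q-1 r≃ m n = mk⇔
  (λ le → to (ℚᵘ.≤-respˡ-≃ lhs (ℚᵘ.≤-respʳ-≃ (toℚᵘ-/1 n) (ℚ.toℚᵘ-mono-≤ le))))
  (λ le → ℚ.toℚᵘ-cancel-≤ (ℚᵘ.≤-respˡ-≃ (ℚᵘ.≃-sym lhs) (ℚᵘ.≤-respʳ-≃ (ℚᵘ.≃-sym (toℚᵘ-/1 n)) (from le))))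
  where
  lhs : toℚᵘ (r ℚ.* (ℤ.+ m ℚ./ 1)) ℚᵘ.≃ mkℚᵘ (ℤ.+ p) q-1 ℚᵘ.* mkℚᵘ (ℤ.+ m) 0
  lhs = ℚᵘ.≃-trans (ℚ.toℚᵘ-homo-* r (ℤ.+ m ℚ./ 1)) (ℚᵘ.*-cong r≃ (toℚᵘ-/1 m))
  num : ℤ.+ p ℤ.* ℤ.+ m ℤ.* ℤ.+ 1 ≡ ℤ.+ (m * p)
  num = trans (ℤ.*-identityʳ _) (trans (sym (ℤ.pos-* p m)) (cong ℤ.+_ (*-comm p m)))
  den : ℤ.+ n ℤ.* ℤ.+ (suc q-1 * 1) ≡ ℤ.+ (n * suc q-1)
  den = trans (sym (ℤ.pos-* n _)) (cong (λ b → ℤ.+ (n * b)) (*-identityʳ (suc q-1)))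
  to : mkℚᵘ (ℤ.+ p) q-1 ℚᵘ.* mkℚᵘ (ℤ.+ m) 0 ℚᵘ.≤ mkℚᵘ (ℤ.+ n) 0 → m * p ≤ n * suc q-1
  to (ℚᵘ.*≤* le) = ℤ.drop‿+≤+ (subst₂ ℤ._≤_ num den le)
  from : m * p ≤ n * suc q-1 → mkℚᵘ (ℤ.+ p) q-1 ℚᵘ.* mkℚᵘ (ℤ.+ m) 0 ℚᵘ.≤ mkℚᵘ (ℤ.+ n) 0
  from le = ℚᵘ.*≤* (subst₂ ℤ._≤_ (sym num) (sym den) (ℤ.+≤+ le))

*-≤-positive : ∀ ρ → 0ℚ ℚ.< ρ → ∀ m n →
               ρ ℚ.* (ℤ.+ m ℚ./ 1) ℚ.≤ ℤ.+ n ℚ./ 1 ⇔ m * ∣ ↥ ρ ∣ ≤ n * ↧ₙ ρ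
*-≤-positive (ℚ.mkℚ (ℤ.+ p) q-1 _)        0<ρ m n = *-≤-/1 _ p q-1 ℚᵘ.≃-refl m n
*-≤-positive (ℚ.mkℚ (ℤ.-[1+ p ]) q-1 _) (ℚ.*<* ())

-- The algorithm on partial colourings

module Greedy (I : Instance) where
  open Instance I hiding (Colouring; Extends; #happy; IsOPT; maxDeg)

  Partial : Set
  Partial = Fin n → Maybe (Fin k)

  0ₖ : Fin k
  0ₖ = fromℕ< (>-nonZero⁻¹ k {{k-nonZero}})

  complete : Partial → Fin n → Fin k
  complete s w = maybe′ id 0ₖ (s w)

  -- Colours are indexed by vertices: an uncoloured vertex stands for the default colour. A loop
  -- over the vertices thus replaces a loop over all `k` colours.
  candidate : Fin n → Fin k
  candidate = complete c

  compatible : Fin k → Maybe (Fin k) → Bool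
  compatible i nothing  = true
  compatible i (just j) = does (j Fin.≟ i)

  -- The vertex v is also given by its index j, which is what the program keeps.
  near : Fin n → ℕ → Fin n → Bool
  near v j w = does (v ~? w) ∨ (j ≡ᵇ toℕ w)

  -- The first conjunct says that v itself can take the colour `i`. It is phrased as a count over
  -- all vertices so that the program has no entry to look up.
  feasible : Fin n → ℕ → Fin k → Partial → Bool
  feasible v j i s =
    does (1 ≤? count (λ w → (j ≡ᵇ toℕ w) ∧ compatible i (s w)) (allFin n)) ∧
    does (count (λ w → does (v ~? w)) (allFin n) * ∣ ↥ ρ ∣ ≤?
          count (λ w → does (v ~? w) ∧ compatible i (s w)) (allFin n) * ↧ₙ ρ)

  paint : Fin n → ℕ → Fin k → Partial → Partial
  paint v j i s w = ifᵇ near v j w then just (maybe′ id i (s w)) else s w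

  attempt : Fin n → ℕ → Partial → Fin n → Partial
  attempt v j s u = ifᵇ feasible v j (candidate u) s then paint v j (candidate u) s else s

  process : Fin n → ℕ → Partial → Partial
  process v j s = foldl (attempt v j) s (allFin n)

  sweep : ℕ × Partial → Fin n → ℕ × Partial
  sweep (j , s) v = suc j , process v j s

  result : Partial
  result = proj₂ (foldl sweep (0 , c) (allFin n))

  output : Fin n → Fin k
  output = complete result

  -- The vertices come in increasing order, so the counter always equals the index of the current
  -- vertex. From here on `toℕ v` replaces it.
  foldl-sweep : ∀ {m} (h : Fin m → Fin n) j s → (∀ i → toℕ (h i) ≡ j + toℕ i) →
    proj₂ (foldl sweep (j , s) (tabulate h)) ≡ foldl (λ s v → process v (toℕ v) s) s (tabulate h)
  foldl-sweep {zero}  h j s h≡ = refl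
  foldl-sweep {suc m} h j s h≡ rewrite trans (h≡ Fin.zero) (+-identityʳ j) =
    foldl-sweep (h ∘ Fin.suc) (suc j) (process (h Fin.zero) j s) (λ i → trans (h≡ (Fin.suc i)) (+-suc j (toℕ i)))

  -- Sealed vertices, the invariant and covering

  infix 4 _∈N[_] _⊑_ _⊑ᶜ_

  _∈N[_] : Fin n → Fin n → Set
  w ∈N[ v ] = near v (toℕ v) w ≡ true

  self : ∀ v → v ∈N[ v ]
  self v rewrite ≡ᵇ-refl (toℕ v) = ∨-zeroʳ _

  neighbour : ∀ {v w} → v ~ w → w ∈N[ v ]
  neighbour {v} {w} v~w rewrite dec-true (v ~? w) v~w = refl

  ∈N⁻ : ∀ {v w} → w ∈N[ v ] → v ≡ w ⊎ v ~ w
  ∈N⁻ {v} {w} w∈ with v ~? w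
  ... | yes v~w = inj₂ v~w
  ... | no  _   = inj₁ (Fin.toℕ-injective (≡ᵇ-true _ _ w∈))

  _⊑_ : Partial → Partial → Set
  s ⊑ s′ = ∀ w i → s w ≡ just i → s′ w ≡ just i

  _⊑ᶜ_ : Partial → Colouring I → Set
  s ⊑ᶜ c′ = ∀ w i → s w ≡ just i → c′ w ≡ i

  -- Quantifying over all completions makes this monotone in the partial colouring, so later
  -- painting cannot undo it.
  record Sealed (s : Partial) (v : Fin n) : Set where
    constructor seal
    field
      happy : ∀ c′ → s ⊑ᶜ c′ → Happy c′ v

  open Sealed

  Sealed-mono : ∀ {s s′ v} → s ⊑ s′ → Sealed s v → Sealed s′ v
  Sealed-mono s⊑ sealed = seal λ c′ s′⊑ → happy sealed c′ λ w i eq → s′⊑ w i (s⊑ w i eq)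

  Happy⇔ : ∀ c′ v → Happy c′ v ⇔ deg v * ∣ ↥ ρ ∣ ≤ sameColouredNeighbours c′ v * ↧ₙ ρ
  Happy⇔ c′ v = *-≤-positive ρ 0<ρ (deg v) (sameColouredNeighbours c′ v)

  deg≡ : ∀ v → deg v ≡ count (λ w → does (v ~? w)) (allFin n)
  deg≡ v = length-filter≡count (v ~?_) (allFin n)

  same≡ : ∀ c′ v → sameColouredNeighbours c′ v ≡
                   count (λ w → does (v ~? w) ∧ does (c′ w Fin.≟ c′ v)) (allFin n)
  same≡ c′ v = length-filter≡count (λ w → (v ~? w) ×-dec (c′ w Fin.≟ c′ v)) (allFin n)

  ⊑-paint : ∀ v j i s → s ⊑ paint v j i s
  ⊑-paint v j i s w l eq rewrite eq with near v j w
  ... | true  = refl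
  ... | false = refl

  ⊑-attempt : ∀ v j s u → s ⊑ attempt v j s u
  ⊑-attempt v j s u with feasible v j (candidate u) s
  ... | true  = ⊑-paint v j (candidate u) s
  ... | false = λ _ _ eq → eq

  paint-compatible : ∀ {v i s w} c′ → paint v (toℕ v) i s ⊑ᶜ c′ → w ∈N[ v ] →
                     compatible i (s w) ≡ true → c′ w ≡ i
  paint-compatible {v} {i} {s} {w} c′ ext w∈ ok = ext w i painted
    where
    painted : paint v (toℕ v) i s w ≡ just i
    painted rewrite w∈ with s w
    ... | nothing = refl
    ... | just j  = cong just (does-true (j Fin.≟ i) ok)

  paint-happy : ∀ v i s → feasible v (toℕ v) i s ≡ true → ∀ c′ → paint v (toℕ v) i s ⊑ᶜ c′ → Happy c′ v
  paint-happy v i s ok c′ ext = Equivalence.from (Happy⇔ c′ v) (begin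
    deg v * ∣ ↥ ρ ∣                                ≡⟨ cong (_* _) (deg≡ v) ⟩
    count _ (allFin n) * ∣ ↥ ρ ∣                   ≤⟨ does-true (_ ≤? _) (proj₂ (∧-true⁻ ok)) ⟩
    count _ (allFin n) * ↧ₙ ρ                      ≤⟨ *-monoˡ-≤ (↧ₙ ρ) (count-mono same (allFin n)) ⟩
    count _ (allFin n) * ↧ₙ ρ                      ≡⟨ cong (_* _) (sym (same≡ c′ v)) ⟩
    sameColouredNeighbours c′ v * ↧ₙ ρ             ∎)
    where
    open ≤-Reasoning
    c′v≡i : c′ v ≡ i
    -- The only vertex that the first count of `feasible` can register is v, so v is compatible with
    -- `i`.
    c′v≡i with count>0⁻ _ (allFin n) (does-true (1 ≤? _) (proj₁ (∧-true⁻ ok)))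
    ... | w , eq with ∧-true⁻ {toℕ v ≡ᵇ toℕ w} eq
    ...   | v≡w , compat with Fin.toℕ-injective (≡ᵇ-true (toℕ v) (toℕ w) v≡w)
    ...     | refl = paint-compatible {s = s} c′ ext (self v) compat
    same : ∀ w → does (v ~? w) ∧ compatible i (s w) ≡ true → does (v ~? w) ∧ does (c′ w Fin.≟ c′ v) ≡ true
    same w = ∧-monoʳ (does (v ~? w)) λ v~w compat → dec-true (c′ w Fin.≟ c′ v)
      (trans (paint-compatible {s = s} c′ ext (neighbour (does-true (v ~? w) v~w)) compat) (sym c′v≡i))

  paint-seals : ∀ v i s → feasible v (toℕ v) i s ≡ true → Sealed (paint v (toℕ v) i s) v
  paint-seals v i s ok = seal (paint-happy v i s ok)

  -- Every vertex whose state differs from `c` is charged to a sealed vertex in whose closed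
  -- neighbourhood it lies.
  Invariant : Partial → Set
  Invariant s = c ⊑ s × (∀ w → s w ≡ c w ⊎ ∃[ v ] Sealed s v × w ∈N[ v ])

  -- Two closed neighbourhoods meet in `w`, so v has distance at most 2 from a sealed vertex.
  Covered : Partial → Fin n → Set
  Covered s v = ∃[ v′ ] ∃[ w ] Sealed s v′ × w ∈N[ v′ ] × w ∈N[ v ]

  Covered-mono : ∀ {s s′ v} → s ⊑ s′ → Covered s v → Covered s′ v
  Covered-mono s⊑ (v′ , w , sealed , ws) = v′ , w , Sealed-mono s⊑ sealed , ws

  attempt-invariant : ∀ v s u → Invariant s → Invariant (attempt v (toℕ v) s u)
  attempt-invariant v s u (c⊑s , new) with feasible v (toℕ v) (candidate u) s in ok
  ... | false = c⊑s , new
  ... | true  = (λ w l eq → ⊑p w l (c⊑s w l eq)) , new′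
    where
    i = candidate u
    ⊑p = ⊑-paint v (toℕ v) i s
    new′ : ∀ w → paint v (toℕ v) i s w ≡ c w ⊎ ∃[ v′ ] Sealed (paint v (toℕ v) i s) v′ × w ∈N[ v′ ]
    new′ w with near v (toℕ v) w in w∈
    ... | true  = inj₂ (v , paint-seals v i s ok , w∈)
    ... | false with new w
    ...   | inj₁ eq               = inj₁ eq
    ...   | inj₂ (v′ , sealed , w∈′) = inj₂ (v′ , Sealed-mono ⊑p sealed , w∈′)

  -- Feasibility with respect to `c` thus survives until the turn of v, as long as N[v] is
  -- untouched.
  feasible-local : ∀ v i s s′ → (∀ w → w ∈N[ v ] → s w ≡ s′ w) → feasible v (toℕ v) i s ≡ feasible v (toℕ v) i s′
  feasible-local v i s s′ agree = cong₂ (λ a b → does (1 ≤? a) ∧ does (count (λ w → does (v ~? w)) (allFin n) * ∣ ↥ ρ ∣ ≤? b * ↧ₙ ρ))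
    (count-cong (λ w → restrict w (λ eq → trans (cong (does (v ~? w) ∨_) eq) (∨-zeroʳ _))) (allFin n))
    (count-cong (λ w → restrict w (λ eq → cong (_∨ _) eq)) (allFin n))
    where
    restrict : ∀ w {b} → (b ≡ true → w ∈N[ v ]) → b ∧ compatible i (s w) ≡ b ∧ compatible i (s′ w)
    restrict w {true}  w∈ = cong (compatible i) (agree w (w∈ refl))
    restrict w {false} w∈ = refl

  attempt-covers : ∀ v s u → Invariant s → feasible v (toℕ v) (candidate u) c ≡ true →
                   Covered (attempt v (toℕ v) s u) v
  attempt-covers v s u (_ , new) ok with choose alternatives
    where
    alternatives : ∀ w → (w ∈N[ v ] → s w ≡ c w) ⊎ ((∃[ v′ ] Sealed s v′ × w ∈N[ v′ ]) × w ∈N[ v ])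
    alternatives w with near v (toℕ v) w | new w
    ... | false | _         = inj₁ λ ()
    ... | true  | inj₁ eq   = inj₁ λ _ → eq
    ... | true  | inj₂ v′ = inj₂ (v′ , refl)
  ... | inj₂ (w , (v′ , sealed , w∈v′) , w∈v) =
    Covered-mono {s} (⊑-attempt v (toℕ v) s u) (v′ , w , sealed , w∈v′ , w∈v)
  -- Nothing in N[v] has changed, so the attempt succeeds and v covers itself.
  ... | inj₁ agree = v , v , subst (λ s′ → Sealed s′ v) (sym painted) (paint-seals v (candidate u) s ok′) , self v , self v
    where
    ok′ : feasible v (toℕ v) (candidate u) s ≡ true
    ok′ = trans (feasible-local v (candidate u) s c agree) ok
    painted : attempt v (toℕ v) s u ≡ paint v (toℕ v) (candidate u) s
    painted = cong (λ b → ifᵇ b then paint v (toℕ v) (candidate u) s else s) ok′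

  module _ {E : Set} (f : Partial → E → Partial) (⊑f : ∀ s a → s ⊑ f s a)
           (f-invariant : ∀ s a → Invariant s → Invariant (f s a)) where

    foldl-⊑ : ∀ s as → s ⊑ foldl f s as
    foldl-⊑ s []       w i eq = eq
    foldl-⊑ s (a ∷ as) w i eq = foldl-⊑ (f s a) as w i (⊑f s a w i eq)

    foldl-invariant : ∀ s as → Invariant s → Invariant (foldl f s as)
    foldl-invariant s []       inv = inv
    foldl-invariant s (a ∷ as) inv = foldl-invariant (f s a) as (f-invariant s a inv)

    -- The invariant carries through the steps before `a`, and monotonicity preserves the covering
    -- through those after it. Used for the loop over colours and again for the loop over vertices.
    foldl-covers : ∀ {v a} → (∀ s → Invariant s → Covered (f s a) v) →
                   ∀ s {as} → Invariant s → a ∈ as → Covered (foldl f s as) v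
    foldl-covers f-covers s {a ∷ as} inv (here refl) = Covered-mono {f s a} (foldl-⊑ (f s a) as) (f-covers s inv)
    foldl-covers f-covers s {b ∷ as} inv (there a∈)  = foldl-covers f-covers (f s b) (f-invariant s b inv) a∈

  module _ (v : Fin n) where

    private
      a  = attempt v (toℕ v)
      ⊑a = ⊑-attempt v (toℕ v)
      inv = attempt-invariant v

    ⊑-process : ∀ s → s ⊑ process v (toℕ v) s
    ⊑-process s = foldl-⊑ a ⊑a inv s (allFin n)

    process-invariant : ∀ s → Invariant s → Invariant (process v (toℕ v) s)
    process-invariant s = foldl-invariant a ⊑a inv s (allFin n)

    process-covers : ∀ {u} → feasible v (toℕ v) (candidate u) c ≡ true →
                     ∀ s → Invariant s → Covered (process v (toℕ v) s) v
    process-covers {u} ok s i = foldl-covers a ⊑a inv (λ s i → attempt-covers v s u i ok) s i (∈-allFin u)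

  result≡ : result ≡ foldl (λ s v → process v (toℕ v) s) c (allFin n)
  result≡ = foldl-sweep id 0 c (λ _ → refl)

  initial-invariant : Invariant c
  initial-invariant = (λ _ _ eq → eq) , λ _ → inj₁ refl

  result-invariant : Invariant result
  result-invariant = subst Invariant (sym result≡)
    (foldl-invariant _ (λ s v → ⊑-process v s) (λ s v → process-invariant v s) c (allFin n) initial-invariant)

  result-covers : ∀ {v u} → feasible v (toℕ v) (candidate u) c ≡ true → Covered result v
  result-covers {v} ok = subst (λ s → Covered s v) (sym result≡)
    (foldl-covers _ (λ s v → ⊑-process v s) (λ s v → process-invariant v s)
      (process-covers v ok) c initial-invariant (∈-allFin v))

  result⊑output : result ⊑ᶜ output
  result⊑output w i eq rewrite eq = refl

  output-extends : Extends I output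
  output-extends w i eq = result⊑output w i (proj₁ result-invariant w i eq)

  -- The vertices that agree with v under `c′` are among those that can take `i`, so the threshold
  -- is met in `i` too. The freedom to take `i` different from `c′ v` allows the switch to the
  -- default colour.
  happy-feasible : ∀ {c′ v i} → Happy c′ v → compatible i (c v) ≡ true →
                   (∀ w → v ~ w → c′ w ≡ c′ v → compatible i (c w) ≡ true) → feasible v (toℕ v) i c ≡ true
  happy-feasible {c′} {v} {i} v-happy vi ni = cong₂ _∧_
    (dec-true (1 ≤? _) (count>0⁺ _ (∈-allFin v) (cong₂ _∧_ (≡ᵇ-refl (toℕ v)) vi)))
    (dec-true (_ ≤? _) (begin
      count _ (allFin n) * ∣ ↥ ρ ∣            ≡⟨ cong (_* _) (sym (deg≡ v)) ⟩
      deg v * ∣ ↥ ρ ∣                         ≤⟨ Equivalence.to (Happy⇔ c′ v) v-happy ⟩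
      sameColouredNeighbours c′ v * ↧ₙ ρ      ≡⟨ cong (_* _) (same≡ c′ v) ⟩
      count _ (allFin n) * ↧ₙ ρ               ≤⟨ *-monoˡ-≤ (↧ₙ ρ) (count-mono same (allFin n)) ⟩
      count _ (allFin n) * ↧ₙ ρ               ∎))
    where
    open ≤-Reasoning
    same : ∀ w → does (v ~? w) ∧ does (c′ w Fin.≟ c′ v) ≡ true → does (v ~? w) ∧ compatible i (c w) ≡ true
    same w = ∧-monoʳ (does (v ~? w)) λ v~w c′w≡ →
      ni w (does-true (v ~? w) v~w) (does-true (c′ w Fin.≟ c′ v) c′w≡)

  compatible-intro : ∀ {i} m → (∀ j → m ≡ just j → j ≡ i) → compatible i m ≡ true
  compatible-intro nothing  j≡i = refl
  compatible-intro (just j) j≡i = dec-true (j Fin.≟ _) (j≡i j refl)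

  ≢-or-≡ : ∀ m (i : Fin k) → m ≢ just i ⊎ m ≡ just i
  ≢-or-≡ nothing  i = inj₁ λ ()
  ≢-or-≡ (just j) i with j Fin.≟ i
  ... | yes j≡i = inj₂ (cong just j≡i)
  ... | no  j≢i = inj₁ (j≢i ∘ just-injective)

  -- If some u is precoloured with `c′ v`, then `candidate u` is that colour. Otherwise no vertex of
  -- N[v] is, so those sharing the colour of v under `c′`, v included, are uncoloured in `c`, and
  -- `candidate v` suits them all.
  happy-covered : ∀ {c′ v} → Extends I c′ → Happy c′ v → Covered result v
  happy-covered {c′} {v} ext v-happy = [ uncoloured , coloured ]′ (choose alternatives)
    where
    alternatives : ∀ w → (w ∈N[ v ] → c w ≢ just (c′ v)) ⊎ c w ≡ just (c′ v)
    alternatives w = map₁ (λ c≢ _ → c≢) (≢-or-≡ (c w) (c′ v))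

    coloured : ∃[ u ] c u ≡ just (c′ v) → Covered result v
    coloured (u , cu≡) = result-covers {u = u} (happy-feasible v-happy (compat v refl) (λ w _ → compat w))
      where
      compat : ∀ w → c′ w ≡ c′ v → compatible (candidate u) (c w) ≡ true
      compat w c′w≡ = compatible-intro (c w) λ j cw≡ →
        trans (sym (ext w j cw≡)) (trans c′w≡ (sym (cong (maybe′ id 0ₖ) cu≡)))

    uncoloured : (∀ w → w ∈N[ v ] → c w ≢ just (c′ v)) → Covered result v
    uncoloured free = result-covers {u = v}
      (happy-feasible v-happy (compat v (self v) refl) (λ w v~w → compat w (neighbour v~w)))
      where
      compat : ∀ w → w ∈N[ v ] → c′ w ≡ c′ v → compatible (candidate v) (c w) ≡ true
      compat w w∈ c′w≡ = compatible-intro (c w) λ j cw≡ →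
        contradiction (trans cw≡ (cong just (trans (sym (ext w j cw≡)) c′w≡))) (free w w∈)

  -- Counting happy vertices

  closed : Fin n → List (Fin n)
  closed v = v ∷ filter (v ~?_) (allFin n)

  ∈-closed : ∀ {v w} → w ∈N[ v ] → w ∈ closed v
  ∈-closed {v} {w} w∈ with ∈N⁻ w∈
  ... | inj₁ refl = here refl
  ... | inj₂ v~w  = there (∈-filter⁺ (v ~?_) (∈-allFin w) v~w)

  ∈N-sym : ∀ {v w} → w ∈N[ v ] → v ∈N[ w ]
  ∈N-sym {v} w∈ with ∈N⁻ w∈
  ... | inj₁ refl = self v
  ... | inj₂ v~w  = neighbour (~-sym v~w)

  length-closed : ∀ v → length (closed v) ≤ suc (maxDeg I)
  length-closed v = s≤s (All.lookup (xs≤max 0 (map deg (allFin n))) (∈-map⁺ deg (∈-allFin v)))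

  -- Passing twice to closed neighbourhoods, from the vertices happy under `output`, reaches every
  -- vertex happy under `c′`: once to the common vertex and once on to v. Each passage costs a
  -- factor 1 + Δ.
  #happy≤ : ∀ c′ → Extends I c′ → #happy I c′ ≤ #happy I output * suc (maxDeg I) * suc (maxDeg I)
  #happy≤ c′ ext = begin
    #happy I c′                                          ≤⟨ length-unique-⊆ uniq reach ⟩
    length (concatMap closed (concatMap closed H))       ≤⟨ length-concatMap≤ closed length-closed (concatMap closed H) ⟩
    length (concatMap closed H) * suc (maxDeg I)         ≤⟨ *-monoˡ-≤ _ (length-concatMap≤ closed length-closed H) ⟩
    #happy I output * suc (maxDeg I) * suc (maxDeg I)    ∎
    where
    open ≤-Reasoning
    H : List (Fin n)
    H = filter (happy? output) (allFin n)
    uniq : Unique (filter (happy? c′) (allFin n))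
    uniq = Unique.filter⁺ (happy? c′) (Unique.allFin⁺ n)
    step : ∀ {v w xs} → v ∈ xs → w ∈N[ v ] → w ∈ concatMap closed xs
    step v∈ w∈ = ∈-concatMap⁺ closed (Any.map (λ { refl → ∈-closed w∈ }) v∈)
    reach : ∀ {v} → v ∈ filter (happy? c′) (allFin n) → v ∈ concatMap closed (concatMap closed H)
    reach {v} v∈ =
      let v′ , w , sealed , w∈v′ , w∈v = happy-covered ext (proj₂ (∈-filter⁻ (happy? c′) {xs = allFin n} v∈))
      in step (step (∈-filter⁺ (happy? output) (∈-allFin v′) (happy sealed output result⊑output)) w∈v′) (∈N-sym w∈v)

-- The program

size-head : ∀ t → size (head t) ≤ size t
size-head nil        = ≤-refl
size-head (cons t u) = m≤n⇒m≤1+n (m≤m+n (size t) (size u))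

size-tail : ∀ t → size (tail t) ≤ size t
size-tail nil        = ≤-refl
size-tail (cons t u) = m≤n⇒m≤1+n (m≤n+m (size u) (size t))

length≤size : (f : A → Tree) (xs : List A) → length xs ≤ size (encodeList f xs)
length≤size f []       = z≤n
length≤size f (x ∷ xs) = s≤s (≤-trans (length≤size f xs) (m≤n+m _ (size (f x))))

∣∣ᵇ≤size : ∀ b → ∣ b ∣ᵇ ≤ size (encodeℕᵇ b)
∣∣ᵇ≤size b = subst (λ t → ∣ b ∣ᵇ ≤ size t) (encodeList-bits b) (length≤size encodeBool (bits b))

-- The trailing zeros are left out: head nil = tail nil = nil = encodeBool false.
oneHot : ℕ → Tree
oneHot zero    = cons (encodeBool true) nil
oneHot (suc j) = cons nil (oneHot j)

encodeList-tabulate : ∀ {n} (f : A → Tree) (h : Fin n → A) →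
                      encodeList f (tabulate h) ≡ encodeList (f ∘ h) (allFin n)
encodeList-tabulate {n = n} f h = trans (cong (encodeList f) (sym (map-tabulate id h))) (encodeList-map (allFin n))
  where
  encodeList-map : ∀ xs → encodeList f (map h xs) ≡ encodeList (f ∘ h) xs
  encodeList-map []       = refl
  encodeList-map (x ∷ xs) = cong (cons _) (encodeList-map xs)

zipTrees-nil : ∀ (f : A → Tree) xs → encodeList id (zipTrees f xs nil) ≡ encodeList (λ x → cons (f x) nil) xs
zipTrees-nil f []       = refl
zipTrees-nil f (x ∷ xs) = cong (cons _) (zipTrees-nil f xs)

zipTrees-oneHot : ∀ {n} (f : A → Tree) (h : Fin n → A) j →
  encodeList id (zipTrees f (tabulate h) (oneHot j)) ≡
  encodeList (λ i → cons (f (h i)) (encodeBool (j ≡ᵇ toℕ i))) (allFin n)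
zipTrees-oneHot {n = zero}  f h j       = refl
zipTrees-oneHot {n = suc n} f h zero    = cong (cons _)
  (trans (zipTrees-nil f (tabulate (h ∘ Fin.suc)))
    (trans (encodeList-tabulate _ (h ∘ Fin.suc)) (sym (encodeList-tabulate _ Fin.suc))))
zipTrees-oneHot {n = suc n} f h (suc j) = cong (cons _)
  (trans (zipTrees-oneHot f (h ∘ Fin.suc) j) (sym (encodeList-tabulate _ Fin.suc)))

open Greedy

inputSize : Instance → ℕ
inputSize I = size (encodeInstance I)

encodePartial : ∀ I → Partial I → Tree
encodePartial I s = encodeList (λ w → encodeMaybe encodeFin (s w)) (allFin (Instance.n I))

∣colour∣≤ : ∀ I (i : Fin (Instance.k I)) → ∣ fromℕ (toℕ i) ∣ᵇ ≤ inputSize I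
∣colour∣≤ I i = begin
  ∣ fromℕ (toℕ i) ∣ᵇ   ≤⟨ ∣∣ᵇ-mono (fromℕ (toℕ i)) (fromℕ k)
                            (subst₂ _≤_ (sym (toℕ-fromℕ (toℕ i))) (sym (toℕ-fromℕ k)) (<⇒≤ (Fin.toℕ<n i))) ⟩
  ∣ fromℕ k ∣ᵇ         ≤⟨ ∣∣ᵇ≤size (fromℕ k) ⟩
  size (encodeℕ k)     ≤⟨ ≤-trans (size-head (tail (encodeInstance I))) (size-tail (encodeInstance I)) ⟩
  inputSize I                 ∎
  where
  open ≤-Reasoning
  open Instance I using (k)

length-allFin≤ : ∀ I → length (allFin (Instance.n I)) ≤ inputSize I
length-allFin≤ I = ≤-trans (length≤size _ (allFin (Instance.n I))) (size-head (encodeInstance I))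

-- Colour 0 is the default because its code is `nil`, which is also the tail of the code of
-- `nothing`. So completing a partial colouring is a single `tail`.
tail-encodeMaybe : ∀ I m → tail (encodeMaybe encodeFin m) ≡ encodeFin (maybe′ id (0ₖ I) m)
tail-encodeMaybe I nothing  = cong encodeℕ {x = 0} (sym (Fin.toℕ-fromℕ< (>-nonZero⁻¹ _ {{Instance.k-nonZero I}})))
tail-encodeMaybe I (just i) = refl

module _ {X : Set ℓ} {N : X → ℕ} {e : X → Tree} {P Q : X → ℕᵇ}
         (∣P∣ : Poly N (∣_∣ᵇ ∘ P)) (∣Q∣ : Poly N (∣_∣ᵇ ∘ Q)) where

  -- Equality is two inequalities, each a comparison of products with unary factors 1.
  ≡ᶜ : Computes N e (encodeℕᵇ ∘ P) → Computes N e (encodeℕᵇ ∘ Q) →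
       Computes N e (λ x → encodeBool (does (⟦ P x ⟧ ≟ ⟦ Q x ⟧)))
  ≡ᶜ p q = ext (λ x → cong encodeBool (antisym ⟦ P x ⟧ ⟦ Q x ⟧))
    (andᶜ (*-≤ᶜ one one ∣P∣ ∣Q∣ oneᶜ oneᶜ p q) (*-≤ᶜ one one ∣Q∣ ∣P∣ oneᶜ oneᶜ q p))
    where
    one = poly-const 1
    oneᶜ : Computes N e (λ _ → unary 1)
    -- `unary 1` and `encodeBool true` are the same tree.
    oneᶜ = trueᶜ
    antisym : ∀ a b → does (1 * a ≤? 1 * b) ∧ does (1 * b ≤? 1 * a) ≡ does (a ≟ b)
    antisym a b rewrite *-identityˡ a | *-identityˡ b =
      does-⇔ (mk⇔ (λ (a≤b , b≤a) → ≤-antisym a≤b b≤a) λ { refl → ≤-refl , ≤-refl }) ((a ≤? b) ×-dec (b ≤? a)) (a ≟ b)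

-- Counter and partial colouring are arbitrary here, while `N₁` sees only the instance. This is
-- sound because every loop runs along the vertices or the digits of a number, never along
-- `oneHot j`.
Vertex-step : Set₁
Vertex-step = Σ Instance λ I → Fin (Instance.n I) × ℕ × Partial I

Attempt-step : Set₁
Attempt-step = Σ Vertex-step λ (I , _) → Fin (Instance.n I) × Partial I

row : ∀ I → Fin (Instance.n I) → Tree
row I v = encodeList (λ w → encodeBool (does (Instance._~?_ I v w))) (allFin (Instance.n I))

encodeSweep : ∀ I → ℕ × Partial I → Tree
encodeSweep I (j , s) = cons (oneHot j) (encodePartial I s)

-- The layout is the one that `foldᶜ` imposes: current element, accumulator, enclosing environment.
-- The outer loop runs along the adjacency matrix and so meets each vertex as its row.
env₁ : Vertex-step → Tree
env₁ (I , v , s) = cons (row I v) (cons (encodeSweep I s) (encodeInstance I))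

env₂ : Attempt-step → Tree
env₂ (x@(I , _) , u , s) = cons (encodeMaybe encodeFin (Instance.c I u)) (cons (encodePartial I s) (env₁ x))

N₁ : Vertex-step → ℕ
N₁ = inputSize ∘ proj₁

N₂ : Attempt-step → ℕ
N₂ = N₁ ∘ proj₁

vertices : (y : Attempt-step) → List (Fin (Instance.n (proj₁ (proj₁ y))))
vertices y = allFin _

∣vertices∣ : Poly N₂ (length ∘ vertices)
∣vertices∣ = poly-≤ (λ ((I , _) , _) → length-allFin≤ I) poly-N

-- All that concerns w relative to v is gathered in one record: adjacency, colour, and whether w is
-- v. Testing and painting then become counts and a map, without any lookup.
entry : (y : Attempt-step) → Fin (Instance.n (proj₁ (proj₁ y))) → Tree
entry ((I , v , j , _) , u , s) w =
  cons (cons (encodeBool (does (Instance._~?_ I v w))) (encodeMaybe encodeFin (s w))) (encodeBool (j ≡ᵇ toℕ w))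

entries : Attempt-step → Tree
entries y = encodeList (entry y) (vertices y)

env₃ : Attempt-step → Tree
env₃ y = cons (entries y) (env₂ y)

entriesᶜ : Computes N₂ env₂ entries
entriesᶜ = ext (λ ((I , v , j , _) , u , s) → zipTrees-oneHot _ id j)
  (zipᶜ {encW = λ ((I , v , j , _) , u , s) w →
           cons (encodeBool (does (Instance._~?_ I v w))) (encodeMaybe encodeFin (s w))}
    ∣vertices∣
    (ext (λ ((I , v , j , _) , u , s) → zipTrees-encodeList _ _ (allFin _))
      (zipᶜ {encW = λ ((I , v , _) , _) w → encodeBool (does (Instance._~?_ I v w))}
        ∣vertices∣ (headᶜ (tailᶜ (tailᶜ idᶜ))) (headᶜ (tailᶜ idᶜ))))
    (headᶜ (headᶜ (tailᶜ (tailᶜ (tailᶜ idᶜ))))))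

Entry-step : Set₁
Entry-step = Σ Attempt-step λ y → Fin (Instance.n (proj₁ (proj₁ y)))

env₄ : Entry-step → Tree
env₄ (y , w) = cons (entry y w) (env₃ y)

N₄ : Entry-step → ℕ
N₄ = N₂ ∘ proj₁

adjacentᶜ : Computes N₄ env₄ (λ (((I , v , _) , _) , w) → encodeBool (does (Instance._~?_ I v w)))
adjacentᶜ = headᶜ (headᶜ (headᶜ idᶜ))

colourᶜ : Computes N₄ env₄ (λ ((_ , _ , s) , w) → encodeMaybe encodeFin (s w))
colourᶜ = tailᶜ (headᶜ (headᶜ idᶜ))

selfᶜ : Computes N₄ env₄ (λ (((_ , _ , j , _) , _) , w) → encodeBool (j ≡ᵇ toℕ w))
selfᶜ = tailᶜ (headᶜ idᶜ)

candidateᶜ : Computes N₄ env₄ (λ (((I , _) , u , _) , _) → encodeFin (candidate I u))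
candidateᶜ = ext (λ (((I , _) , u , _) , _) → tail-encodeMaybe I (Instance.c I u))
  (tailᶜ (headᶜ (tailᶜ (tailᶜ idᶜ))))

compatibleᶜ : Computes N₄ env₄
  (λ (((I , _) , u , s) , w) → encodeBool (compatible I (candidate I u) (s w)))
compatibleᶜ = ext (λ (((I , _) , u , s) , w) → test I (candidate I u) (s w))
  (ifᶜ colourᶜ
    (≡ᶜ (poly-≤ (λ (((I , _) , u , s) , w) → ∣colour∣≤ I (complete I s w)) poly-N)
        (poly-≤ (λ (((I , _) , u , s) , w) → ∣colour∣≤ I (candidate I u)) poly-N)
        (ext (λ (((I , _) , _ , s) , w) → tail-encodeMaybe I (s w)) (tailᶜ colourᶜ))
        candidateᶜ)
    trueᶜ)
  where
  test : ∀ I i m →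
    (ifᵗ encodeMaybe encodeFin m
     then encodeBool (does (⟦ fromℕ (toℕ (maybe′ id (0ₖ I) m)) ⟧ ≟ ⟦ fromℕ (toℕ i) ⟧))
     else encodeBool true) ≡ encodeBool (compatible I i m)
  test I i nothing  = refl
  test I i (just j) rewrite toℕ-fromℕ (toℕ j) | toℕ-fromℕ (toℕ i) =
    cong encodeBool (does-⇔ (mk⇔ Fin.toℕ-injective (cong toℕ)) (toℕ j ≟ toℕ i) (j Fin.≟ i))

paintᶜ : Computes N₄ env₄
  (λ (((I , v , j , _) , u , s) , w) → encodeMaybe encodeFin (paint I v j (candidate I u) s w))
paintᶜ = ext (λ (((I , v , j , _) , u , s) , w) →
    painted (does (Instance._~?_ I v w)) (j ≡ᵇ toℕ w) (candidate I u) (s w))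
  (ifᶜ adjacentᶜ keep (ifᶜ selfᶜ keep colourᶜ))
  where
  keep = ifᶜ colourᶜ colourᶜ (nilᶜ ,ᶜ candidateᶜ)
  painted : ∀ {k} a b (i : Fin k) m →
    let c = encodeMaybe encodeFin m
        t = ifᵗ c then c else cons nil (encodeFin i)
    in ifᵗ encodeBool a then t else (ifᵗ encodeBool b then t else c) ≡
       encodeMaybe encodeFin (ifᵇ a ∨ b then just (maybe′ id i m) else m)
  painted true  b     i nothing  = refl
  painted true  b     i (just _) = refl
  painted false true  i nothing  = refl
  painted false true  i (just _) = refl
  painted false false i m        = refl

entriesAtᶜ : Computes N₂ env₃ entries
entriesAtᶜ = headᶜ idᶜ

feasibleᶜ : Computes N₂ env₃ (λ ((I , v , j , _) , u , s) → encodeBool (feasible I v j (candidate I u) s))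
feasibleᶜ = andᶜ
  (leqᶜ (∣count∣ _) trueᶜ (countᶜ ∣vertices∣ entriesAtᶜ (andᶜ selfᶜ compatibleᶜ)))
  (ext (λ ((I , v , j , _) , u , s) → cong encodeBool (threshold
      (count (λ w → does (Instance._~?_ I v w)) (allFin _))
      (count (λ w → does (Instance._~?_ I v w) ∧ compatible I (candidate I u) (s w)) (allFin _))
      ∣ ↥ Instance.ρ I ∣ (↧ₙ Instance.ρ I)))
    (*-≤ᶜ (∣count∣ _) (∣count∣ _)
      (poly-≤ (λ ((I , _) , _) → ≤-trans (∣∣ᵇ≤size _) (≤-trans (size-head (tail (tail (tail (encodeInstance I))))) (size-tail³ I))) poly-N)
      (poly-≤ (λ ((I , _) , _) → ≤-trans (∣∣ᵇ≤size _) (≤-trans (size-tail (tail (tail (tail (encodeInstance I))))) (size-tail³ I))) poly-N)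
      (countᶜ ∣vertices∣ entriesAtᶜ adjacentᶜ)
      (countᶜ ∣vertices∣ entriesAtᶜ (andᶜ adjacentᶜ compatibleᶜ))
      (headᶜ (tailᶜ (tailᶜ (tailᶜ instanceᶜ)))) (tailᶜ (tailᶜ (tailᶜ (tailᶜ instanceᶜ))))))
  where
  instanceᶜ : Computes N₂ env₃ (λ ((I , _) , _) → encodeInstance I)
  instanceᶜ = tailᶜ (tailᶜ (tailᶜ (tailᶜ (tailᶜ idᶜ))))
  ∣count∣ : (P : ∀ y → Fin (Instance.n (proj₁ (proj₁ y))) → Bool) → Poly N₂ (λ y → count (P y) (vertices y))
  ∣count∣ P = poly-≤ (λ y → count≤length (P y) (vertices y)) ∣vertices∣
  threshold : ∀ a b p q → does (a * ⟦ fromℕ p ⟧ ≤? b * ⟦ fromℕ q ⟧) ≡ does (a * p ≤? b * q)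
  threshold a b p q rewrite toℕ-fromℕ p | toℕ-fromℕ q = refl
  size-tail³ : ∀ I → size (tail (tail (tail (encodeInstance I)))) ≤ inputSize I
  size-tail³ I = ≤-trans (size-tail (tail (tail (encodeInstance I))))
    (≤-trans (size-tail (tail (encodeInstance I))) (size-tail (encodeInstance I)))

attemptᶜ : Computes N₂ env₂ (λ ((I , v , j , _) , u , s) → encodePartial I (attempt I v j s u))
attemptᶜ = letᶜ entriesᶜ
  (ext (λ ((I , v , j , _) , u , s) → ifᵗ-bool (encodePartial I) (feasible I v j (candidate I u) s))
    (ifᶜ feasibleᶜ (mapᶜ ∣vertices∣ entriesAtᶜ paintᶜ) (headᶜ (tailᶜ (tailᶜ idᶜ)))))

processᶜ : Computes N₁ env₁ (λ (I , v , s) → encodeSweep I (sweep I s v))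
-- Prepending `nil` advances the one-hot list to the next index. The inner loop runs along the
-- encoded `c`, from which each candidate is read off.
processᶜ = (nilᶜ ,ᶜ headᶜ (headᶜ (tailᶜ idᶜ))) ,ᶜ
  foldᶜ {encE = λ (I , _) u → encodeMaybe encodeFin (Instance.c I u)} {encS = λ (I , _) → encodePartial I}
    {step = λ (I , v , j , _) → attempt I v j}
    {L = λ (I , _) → allFin (Instance.n I)} {s₀ = λ (_ , _ , _ , s) → s}
    (poly-≤ (λ (I , _) → length-allFin≤ I) poly-N)
    (headᶜ (tailᶜ (tailᶜ (tailᶜ (tailᶜ idᶜ)))))
    (tailᶜ (headᶜ (tailᶜ idᶜ)))
    attemptᶜ

-- The exponent of the time bound must not be unfolded: it is large.
abstract

  greedyᶜ : Computes inputSize encodeInstance (λ I → encodeColouring (output I))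
  greedyᶜ = mapᶜ {L = λ I → allFin (Instance.n I)} {encW = λ I w → encodeMaybe encodeFin (result I w)}
    (poly-≤ length-allFin≤ poly-N)
    (tailᶜ (foldᶜ {encE = row} {encS = encodeSweep} {step = sweep}
      {L = λ I → allFin (Instance.n I)} {s₀ = λ I → 0 , Instance.c I}
      (poly-≤ length-allFin≤ poly-N) (headᶜ idᶜ)
      -- The first component is `oneHot 0`.
      ((trueᶜ ,ᶜ nilᶜ) ,ᶜ headᶜ (tailᶜ (tailᶜ idᶜ)))
      processᶜ))
    (ext (λ (I , w) → tail-encodeMaybe I (result I w)) (tailᶜ (headᶜ idᶜ)))

-- The running time

program : Program
program = Computes.prog greedyᶜ

greedy-outputs : ∀ I → Outputs program (encodeInstance I) (encodeColouring (output I))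
greedy-outputs I = _ , Computes.run greedyᶜ I

greedy-polynomial : PolynomialTime program encodeInstance
-- Every tree has size at least 1, so the base 2 + M is at most 3M.
greedy-polynomial = 3 ^ d , d , λ I → _ , _ , Computes.run greedyᶜ I , bound I
  where
  d : ℕ
  d = proj₁ (Computes.poly greedyᶜ)
  ^-distribʳ-* : ∀ m n d → (m * n) ^ d ≡ m ^ d * n ^ d
  ^-distribʳ-* m n zero    = refl
  ^-distribʳ-* m n (suc d) = trans (cong (m * n *_) (^-distribʳ-* m n d)) (rearrange m n (m ^ d) (n ^ d))
    where
    rearrange : ∀ a b c d → a * b * (c * d) ≡ a * c * (b * d)
    rearrange = solve-∀
  size>0 : ∀ t → 1 ≤ size t
  size>0 nil        = s≤s z≤n
  size>0 (cons _ _) = s≤s z≤n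
  bound : ∀ I → Computes.time greedyᶜ I ≤ 3 ^ d * size (encodeInstance I) ^ d
  bound I = begin
    Computes.time greedyᶜ I      ≤⟨ proj₂ (Computes.poly greedyᶜ) I ⟩
    (2 + M) ^ d                  ≤⟨ ^-monoˡ-≤ d (+-monoˡ-≤ M (*-monoʳ-≤ 2 (size>0 (encodeInstance I)))) ⟩
    (2 * M + M) ^ d              ≡⟨ cong (_^ d) (triple M) ⟩
    (3 * M) ^ d                  ≡⟨ ^-distribʳ-* 3 M d ⟩
    3 ^ d * M ^ d                ∎
    where
    open ≤-Reasoning
    M = size (encodeInstance I)
    triple : ∀ m → 2 * m + m ≡ 3 * m
    triple = solve-∀

-- The approximation ratio

[1+m]²≤4m³ : ∀ m .{{_ : NonZero m}} → suc m * suc m ≤ 4 * m ^ 3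
[1+m]²≤4m³ m = begin
  -- That m is at least 1 gives both 1 + m ≤ 2m and m² ≤ m³. The resulting 4 is the origin of α =
  -- 1/4.
  suc m * suc m              ≤⟨ *-mono-≤ 1+m≤2m 1+m≤2m ⟩
  (m + m) * (m + m)          ≡⟨ square m ⟩
  4 * (m * (m * 1))          ≤⟨ *-monoʳ-≤ 4 (m≤n*m (m * (m * 1)) m) ⟩
  4 * m ^ 3                  ∎
  where
  open ≤-Reasoning
  1+m≤2m : suc m ≤ m + m
  1+m≤2m = +-monoˡ-≤ m (>-nonZero⁻¹ m)
  square : ∀ m → (m + m) * (m + m) ≡ 4 * (m * (m * 1))
  square = solve-∀

quarter-≤ : ∀ d .{{_ : NonZero d}} m n → m ≤ n * (4 * d) →
            (ℤ.+ 1 ℚ./ 4) ℚ.* (ℤ.+ 1 ℚ./ d) ℚ.* (ℤ.+ m ℚ./ 1) ℚ.≤ ℤ.+ n ℚ./ 1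
quarter-≤ d@(suc d-1) m n m≤ = Equivalence.from
  -- The fraction is 1/(4d); `mkℚᵘ` stores the denominator less one, hence `pred`.
  (*-≤-/1 ((ℤ.+ 1 ℚ./ 4) ℚ.* (ℤ.+ 1 ℚ./ d)) 1 (pred (4 * d))
    (ℚᵘ.≃-trans (ℚ.toℚᵘ-homo-* (ℤ.+ 1 ℚ./ 4) (ℤ.+ 1 ℚ./ d))
      (ℚᵘ.*-cong {toℚᵘ (ℤ.+ 1 ℚ./ 4)} {mkℚᵘ (ℤ.+ 1) 3} ℚᵘ.≃-refl (ℚ.toℚᵘ-fromℚᵘ (mkℚᵘ (ℤ.+ 1) d-1)))) m n)
  (≤-trans (≤-reflexive (*-identityʳ m)) m≤)

theoremB2 :
  ∃[ α ] 0ℚ ℚ.< α × (∃[ A ]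
    PolynomialTime A encodeInstance ×
    (∀ (I : Instance) .{{_ : NonZero (maxDeg I)}} →
      ∃[ c′ ] Outputs A (encodeInstance I) (encodeColouring c′)
            × Extends I c′
            × (∀ OPT → IsOPT I OPT →
                α ℚ.* (maxDeg I ⁻³) ℚ.* (ℤ.+ OPT ℚ./ 1) ℚ.≤ ℤ.+ #happy I c′ ℚ./ 1)))
theoremB2 = ℤ.+ 1 ℚ./ 4 , ℚ.*<* (ℤ.+<+ (s≤s z≤n)) , program , greedy-polynomial ,
  λ I → output I , greedy-outputs I , output-extends I , approximates I
  where
  approximates : ∀ I .{{_ : NonZero (maxDeg I)}} OPT → IsOPT I OPT →
                 (ℤ.+ 1 ℚ./ 4) ℚ.* (maxDeg I ⁻³) ℚ.* (ℤ.+ OPT ℚ./ 1) ℚ.≤ ℤ.+ #happy I (output I) ℚ./ 1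
  approximates I OPT ((c′ , extends , c′-optimal) , _) =
    quarter-≤ (maxDeg I ^ 3) {{m^n≢0 (maxDeg I) 3}} OPT (#happy I (output I)) (begin
      OPT                          ≡⟨ sym c′-optimal ⟩
      #happy I c′                  ≤⟨ #happy≤ I c′ extends ⟩
      h * suc Δ * suc Δ            ≡⟨ *-assoc h (suc Δ) (suc Δ) ⟩
      h * (suc Δ * suc Δ)          ≤⟨ *-monoʳ-≤ h ([1+m]²≤4m³ Δ) ⟩
      h * (4 * Δ ^ 3)              ∎)
    where
    open ≤-Reasoning
    Δ = maxDeg I
    h = #happy I (output I)
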